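{- Let $a=(a_1,\dots,a_\ell)$ be a composition (a sequence of positive integers) of length $\ell\ge1$, and let $\tau_{112}(a)$ denote the partition $12\cdots \ell\,\ell^{a_\ell-1}(\ell-1)^{a_{\ell-1}-1}\cdots 1^{a_1-1}$. Define $F_a(x,y)=\sum_{n,k\ge0}p_{n,k}(112,\tau_{112}(a))x^ny^k$. Then \[F_a(x,y)=\sum_{j=0}^{\ell-1}\frac{x^{a_1+\cdots+a_j}y^j(1-x)}{\prod_{i=1}^{j+1}\bigl(1-x(1+y)+x^{a_i}y\bigr)},\] where the empty sum $a_1+\dots+a_0$ is $0$.
   Context: A set partition of $[n]=\{1,\dots,n\}$ with blocks $B_1,B_2,\dots,B_k$ ordered so that $\min B_1<\min B_2<\cdots$ is represented by its canonical sequential form $\pi=\pi_1\cdots\pi_n$ where $j\in B_{\pi_j}$; equivalently, $\pi$ is a word with $\pi_1=1$, onto $[k]$, and $\pi_{i+1}\le \max(\pi_1,\dots,\pi_i)+1$. For $n=0$ there is one (empty) partition. A partition $\pi$ contains a pattern (partition) $\tau=\tau_1\cdots\tau_m$ if $\pi$ has a subsequence $\pi_{f(1)}\cdots\pi_{f(m)}$ ($f(1)<\dots<f(m)$) order-isomorphic to $\tau$ (i.e. $\pi_{f(i)}<\pi_{f(j)}$ iff $\tau_i<\tau_j$, and $\pi_{f(i)}>\pi_{f(j)}$ iff $\tau_i>\tau_j$); otherwise it avoids $\tau$. $p_{n,k}(T)$ is the number of partitions of $[n]$ with exactly $k$ blocks avoiding every pattern in $T$; $a^q$ denotes $q$ copies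 of the symbol $a$. -}

module Defs where

open import Algebra.Bundles using (AbelianGroup; RawRing)
import Algebra.Definitions.RawSemiring as RawSemiringDefinitions
import Algebra.Properties.Group as GroupProperties
import Algebra.Properties.Semiring.Sum as SemiringSum
open import Data.Fin.Base as Fin using (Fin; toℕ; zero; suc)
import Data.Fin.Properties as Fin
open import Data.Integer.Base as ℤ using (ℤ; 0ℤ; 1ℤ)
import Data.Integer.Properties as ℤ
open import Data.List.Base as List using (List; []; _∷_; _++_; length; lookup)
open import Data.List.Extrema.Nat using (max)
open import Data.List.Relation.Unary.All as All using (All)
open import Data.Nat.Base as ℕ using (ℕ; zero; suc; _≤_; _<_; _∸_; z≤n; s≤s)
import Data.Nat.Properties as ℕ
open import Data.List.Membership.DecPropositional ℕ._≟_ using (_∈_; _∈?_)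
open import Data.Product.Base using (∃; _×_; _,_)
open import Function.Base using (_∘_)
open import Function.Bundles using (_⇔_; mk⇔; Equivalence)
open import Level using (0ℓ)
open import Relation.Binary.PropositionalEquality
  using (_≡_; _≗_; refl; sym; trans; cong; cong₂; subst₂; module ≡-Reasoning)
open import Relation.Nullary.Decidable using (Dec; yes; no; map′; _×-dec_; _→-dec_; ¬?)
open import Relation.Nullary.Negation using (¬_)
open import Relation.Unary using (Pred; Decidable)

-- Positions are indexed from 0 and letters from 1: π_{i+1} is lookup π i.
Word : Set
Word = List ℕ

-- π is the canonical sequential form of a partition of [length π] with
-- exactly k blocks.
record IsPartition (k : ℕ) (π : Word) : Set where
  constructor isPartition
  field
    letters : All (λ c → 1 ≤ c × c ≤ k) π
    onto    : (c : Fin k) → suc (toℕ c) ∈ π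
    -- At the first position the maximum is over the empty prefix, hence 0,
    -- so that with `letters` this field also says that π starts with 1.
    growth  : (i : Fin (length π)) →
              lookup π i ≤ max 0 (List.take (toℕ i) π) ℕ.+ 1

OrderIsomorphic : ∀ {m} → (Fin m → ℕ) → (Fin m → ℕ) → Set
OrderIsomorphic σ τ = ∀ i j →
  (σ i < σ j ⇔ τ i < τ j) × (σ i ℕ.> σ j ⇔ τ i ℕ.> τ j)

StrictlyIncreasing : ∀ {m n} → (Fin m → Fin n) → Set
StrictlyIncreasing f = ∀ i j → i Fin.< j → f i Fin.< f j

Contains : Word → Word → Set
Contains π τ = ∃ λ (f : Fin (length τ) → Fin (length π)) →
  StrictlyIncreasing f × OrderIsomorphic (lookup π ∘ f) (lookup τ)

Avoids : List Word → Word → Set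
Avoids T π = All (λ τ → ¬ Contains π τ) T

isPartition? : ∀ k → Decidable (IsPartition k)
isPartition? k π = map′ (λ (l , o , g) → isPartition l o g)
  (λ (isPartition l o g) → l , o , g)
  (All.all? (λ c → (1 ℕ.≤? c) ×-dec (c ℕ.≤? k)) π ×-dec
   Fin.all? (λ c → suc (toℕ c) ∈? π) ×-dec
   Fin.all? (λ i → lookup π i ℕ.≤? max 0 (List.take (toℕ i) π) ℕ.+ 1))

_⇔?_ : ∀ {A B : Set} → Dec A → Dec B → Dec (A ⇔ B)
a? ⇔? b? = map′ (λ (f , g) → mk⇔ f g)
  (λ e → Equivalence.to e , Equivalence.from e)
  ((a? →-dec b?) ×-dec (b? →-dec a?))

anyFunction? : ∀ {n} m {P : Pred (Fin m → Fin n) 0ℓ} →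
  (∀ {f g} → f ≗ g → P f → P g) → Decidable P → Dec (∃ P)
anyFunction? zero resp P? =
  map′ (λ p → _ , p) (λ (f , p) → resp (λ ()) p) (P? λ ())
anyFunction? {n} (suc m) {P} resp P? = map′
  (λ (_ , _ , p) → _ , p)
  (λ (f , p) → f zero , f ∘ suc , resp (cons-η f) p)
  (Fin.any? λ x → anyFunction? m (resp ∘ cons-cong x) (P? ∘ cons x))
  where
  cons : Fin n → (Fin m → Fin n) → Fin (suc m) → Fin n
  cons x f zero    = x
  cons x f (suc i) = f i

  cons-cong : ∀ x {f g} → f ≗ g → cons x f ≗ cons x g
  cons-cong x eq zero    = refl
  cons-cong x eq (suc i) = eq i

  cons-η : ∀ f → f ≗ cons (f zero) (f ∘ suc)
  cons-η f zero    = refl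
  cons-η f (suc i) = refl

contains? : ∀ π τ → Dec (Contains π τ)
contains? π τ = anyFunction? (length τ) resp λ f →
  Fin.all? (λ i → Fin.all? λ j → (i Fin.<? j) →-dec (f i Fin.<? f j)) ×-dec
  Fin.all? (λ i → Fin.all? λ j →
    ((lookup π (f i) ℕ.<? lookup π (f j)) ⇔? (lookup τ i ℕ.<? lookup τ j))
    ×-dec
    ((lookup π (f i) ℕ.>? lookup π (f j)) ⇔? (lookup τ i ℕ.>? lookup τ j)))
  where
  resp : ∀ {f g} → f ≗ g →
    StrictlyIncreasing f × OrderIsomorphic (lookup π ∘ f) (lookup τ) →
    StrictlyIncreasing g × OrderIsomorphic (lookup π ∘ g) (lookup τ)
  resp {f} {g} eq (inc , iso) =
    (λ i j → subst₂ Fin._<_ (eq i) (eq j) ∘ inc i j) ,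
    (λ i j → subst₂ (λ x y →
      (lookup π x < lookup π y ⇔ lookup τ i < lookup τ j) ×
      (lookup π x ℕ.> lookup π y ⇔ lookup τ i ℕ.> lookup τ j))
      (eq i) (eq j) (iso i j))

avoids? : ∀ T → Decidable (Avoids T)
avoids? T π = All.all? (λ τ → ¬? (contains? π τ)) T

letters : ℕ → List ℕ
letters k = List.map suc (List.upTo k)

-- All words of length n over the letters 1, …, k, each listed once.
words : ℕ → ℕ → List Word
words zero    k = [] ∷ []
words (suc n) k = List.cartesianProductWith _∷_ (letters k) (words n k)

-- A partition with exactly k blocks is a word over 1, …, k, so filtering
-- `words n k` finds every partition counted by p_{n,k}(T).
p : ℕ → ℕ → List Word → ℕ
p n k T = length
  (List.filter (λ π → isPartition? k π ×-dec avoids? T π) (words n k))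

-- 12⋯ℓ ℓ^{a_ℓ-1} (ℓ-1)^{a_{ℓ-1}-1} ⋯ 1^{a_1-1}, where a_{i+1} is lookup a i.
τ₁₁₂ : List ℕ → Word
τ₁₁₂ a = letters (length a) ++
  List.concatMap (λ i → List.replicate (lookup a i ∸ 1) (suc (toℕ i)))
                 (List.reverse (List.allFin (length a)))

private module Σℤ = SemiringSum ℤ.+-*-semiring

-- f n k is the coefficient of x^n y^k.
ℤ⟦x,y⟧ : RawRing 0ℓ 0ℓ
ℤ⟦x,y⟧ = record
  { Carrier = ℕ → ℕ → ℤ
  ; _≈_     = λ f g → ∀ n k → f n k ≡ g n k
  ; _+_     = λ f g n k → f n k ℤ.+ g n k
  ; _*_     = λ f g n k → ∑[ i ≤ n ] ∑[ j ≤ k ]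
                (f (toℕ i) (toℕ j) ℤ.* g (n ∸ toℕ i) (k ∸ toℕ j))
  ; -_      = λ f n k → ℤ.- f n k
  ; 0#      = λ _ _ → 0ℤ
  ; 1#      = one
  }
  where
  open Σℤ using (sum⁺-syntax)

  one : ℕ → ℕ → ℤ
  one 0 0 = 1ℤ
  one _ _ = 0ℤ

open RawRing ℤ⟦x,y⟧ public
  using (_≈_; _+_; _*_; -_; 0#; 1#) renaming (Carrier to Series)
open RawSemiringDefinitions (RawRing.rawSemiring ℤ⟦x,y⟧) public
  using (_^_) renaming (sum to sumSeries)

infixl 6 _-_
_-_ : Series → Series → Series
f - g = f + - g

X Y : Series
X 1 0 = 1ℤ
X _ _ = 0ℤ
Y 0 1 = 1ℤ
Y _ _ = 0ℤ

∏ : List Series → Series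
∏ = List.foldr _*_ 1#

-- The inverse ∑_{m≥0} (1 - g)^m of a series g with constant term 1.  The
-- powers with m > n + k do not contribute to the coefficient of x^n y^k.
-- If the constant term is not 1, the value carries no meaning.
infix 8 _⁻¹
_⁻¹ : Series → Series
(g ⁻¹) n k = ∑[ m ≤ n ℕ.+ k ] ((1# - g) ^ toℕ m) n k
  where open Σℤ using (sum⁺-syntax)

infixl 7 _/_
_/_ : Series → Series → Series
f / g = f * g ⁻¹

module _ (g : Series) (g₀₀≡1 : g 0 0 ≡ 1ℤ) where
  open GroupProperties (AbelianGroup.group ℤ.+-0-abelianGroup) using (∙-cancelˡ)
  open ≡-Reasoning
  open Σℤ using (sum; sum-syntax; sum⁺-syntax; sum-cong-≗; ∑-comm; ∑-distrib-+;
    sum-replicate-zero; *-distribˡ-sum)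

  private
    u : Series
    u = 1# - g

    u₀₀≡0 : u 0 0 ≡ 0ℤ
    u₀₀≡0 = cong (λ c → 1ℤ ℤ.+ ℤ.- c) g₀₀≡1

    ∑-cong : ∀ n {f h : Fin n → ℤ} → (∀ i → f i ≡ h i) → sum f ≡ sum h
    ∑-cong n = sum-cong-≗

    sum-zero : ∀ {n} (f : Fin n → ℤ) → (∀ i → f i ≡ 0ℤ) → sum f ≡ 0ℤ
    sum-zero {n} f f≡0 = trans (∑-cong n f≡0) (sum-replicate-zero n)

    sum-truncate : ∀ (f : ℕ → ℤ) {M N} → M ≤ N → (∀ m → M ≤ m → f m ≡ 0ℤ) →
      ∑[ m < N ] f (toℕ m) ≡ ∑[ m < M ] f (toℕ m)
    sum-truncate f {N = N} z≤n f≡0 = sum-zero {N} (f ∘ toℕ) λ i → f≡0 (toℕ i) z≤n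
    sum-truncate f (s≤s M≤N) f≡0 = cong (ℤ._+_ (f 0))
      (sum-truncate (f ∘ suc) M≤N λ m M≤m → f≡0 (suc m) (s≤s M≤m))

    degree-drop : ∀ {n k} (i : Fin (suc n)) (j : Fin (suc k)) →
      ∀ (f : ℕ → ℕ → ℤ) (h : ℕ → ℕ → ℤ) →
      (∀ n′ k′ → n′ ℕ.+ k′ < n ℕ.+ k → f n′ k′ ≡ h n′ k′) →
      u (toℕ i) (toℕ j) ℤ.* f (n ∸ toℕ i) (k ∸ toℕ j) ≡
      u (toℕ i) (toℕ j) ℤ.* h (n ∸ toℕ i) (k ∸ toℕ j)
    degree-drop zero zero f h eq rewrite u₀₀≡0 = refl
    degree-drop {suc n} {k} (suc i) j f h eq = cong (ℤ._*_ (u (suc (toℕ i)) (toℕ j)))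
      (eq (n ∸ toℕ i) (k ∸ toℕ j) (s≤s (ℕ.+-mono-≤ (ℕ.m∸n≤m n (toℕ i)) (ℕ.m∸n≤m k (toℕ j)))))
    degree-drop {n} {suc k} zero (suc j) f h eq = cong (ℤ._*_ (u 0 (suc (toℕ j))))
      (eq n (k ∸ toℕ j) (ℕ.+-monoʳ-< n (s≤s (ℕ.m∸n≤m k (toℕ j)))))

    product-cong : ∀ n k (f h : Series) →
      (∀ n′ k′ → n′ ℕ.+ k′ < n ℕ.+ k → f n′ k′ ≡ h n′ k′) →
      (u * f) n k ≡ (u * h) n k
    product-cong n k f h eq =
      ∑-cong (suc n) λ i → ∑-cong (suc k) λ j → degree-drop i j f h eq

    *-zeroʳ : ∀ n k → (u * 0#) n k ≡ 0ℤ
    *-zeroʳ n k = trans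
      (∑-cong (suc n) λ i → sum-zero {suc k} _ λ j → ℤ.*-zeroʳ (u (toℕ i) (toℕ j)))
      (sum-zero {suc n} (λ _ → 0ℤ) λ _ → refl)

    low : ∀ m n k → n ℕ.+ k < m → (u ^ m) n k ≡ 0ℤ
    low (suc m) n k (s≤s n+k≤m) = trans
      (product-cong n k (u ^ m) 0#
        λ n′ k′ lt → low m n′ k′ (ℕ.<-≤-trans lt n+k≤m))
      (*-zeroʳ n k)

    *-distrib-∑ : ∀ N n k →
      ∑[ m < N ] (u * u ^ toℕ m) n k ≡
      (u * (λ n′ k′ → ∑[ m < N ] (u ^ toℕ m) n′ k′)) n k
    *-distrib-∑ N n k = begin
      ∑[ m < N ] ∑[ i ≤ n ] ∑[ j ≤ k ] t m i j
        ≡⟨ ∑-comm (λ m i → ∑[ j ≤ k ] t m i j) ⟩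
      ∑[ i ≤ n ] ∑[ m < N ] ∑[ j ≤ k ] t m i j
        ≡⟨ ∑-cong (suc n) (λ i → ∑-comm (λ m j → t m i j)) ⟩
      ∑[ i ≤ n ] ∑[ j ≤ k ] ∑[ m < N ] t m i j
        ≡⟨ ∑-cong (suc n) (λ i → ∑-cong (suc k) λ j →
             *-distribˡ-sum (u (toℕ i) (toℕ j))
               (λ (m : Fin N) → (u ^ toℕ m) (n ∸ toℕ i) (k ∸ toℕ j))) ⟨
      _ ∎
      where
      t : Fin N → Fin (suc n) → Fin (suc k) → ℤ
      t m i j = u (toℕ i) (toℕ j) ℤ.* (u ^ toℕ m) (n ∸ toℕ i) (k ∸ toℕ j)

    ⁻¹-unfold : ∀ n k → (g ⁻¹) n k ≡ 1# n k ℤ.+ (u * g ⁻¹) n k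
    ⁻¹-unfold n k = cong (ℤ._+_ (1# n k)) (trans (*-distrib-∑ (n ℕ.+ k) n k)
      (product-cong n k _ (g ⁻¹) λ n′ k′ lt →
        sum-truncate (λ m → (u ^ m) n′ k′) lt λ m → low m n′ k′))

    *-identityˡ : ∀ f n k → (1# * f) n k ≡ f n k
    *-identityˡ f n k = begin
      (1ℤ ℤ.* f n k ℤ.+ sum rest₀) ℤ.+ sum rest
        ≡⟨ cong₂ ℤ._+_ (cong₂ ℤ._+_ (ℤ.*-identityˡ (f n k)) (sum-zero rest₀ λ _ → refl))
             (sum-zero rest λ i → sum-zero {suc k} (λ _ → 0ℤ) λ _ → refl) ⟩
      (f n k ℤ.+ 0ℤ) ℤ.+ 0ℤ
        ≡⟨ trans (ℤ.+-identityʳ _) (ℤ.+-identityʳ _) ⟩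
      f n k ∎
      where
      rest₀ : Fin k → ℤ
      rest₀ j = 0ℤ ℤ.* f n (k ∸ suc (toℕ j))
      rest : Fin n → ℤ
      rest i = ∑[ j ≤ k ] (0ℤ ℤ.* f (n ∸ suc (toℕ i)) (k ∸ toℕ j))

    u+g≡1 : ∀ n k → u n k ℤ.+ g n k ≡ 1# n k
    u+g≡1 n k = begin
      1# n k ℤ.+ ℤ.- g n k ℤ.+ g n k   ≡⟨ ℤ.+-assoc (1# n k) _ _ ⟩
      1# n k ℤ.+ (ℤ.- g n k ℤ.+ g n k) ≡⟨ cong (ℤ._+_ (1# n k)) (ℤ.+-inverseˡ (g n k)) ⟩
      1# n k ℤ.+ 0ℤ                    ≡⟨ ℤ.+-identityʳ _ ⟩
      1# n k                           ∎

    *-distribʳ : ∀ f n k → (u * f) n k ℤ.+ (g * f) n k ≡ (1# * f) n k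
    *-distribʳ f n k = begin
      sum (λ i → sum (tᵘ i)) ℤ.+ sum (λ i → sum (tᵍ i))
        ≡⟨ ∑-distrib-+ (λ i → sum (tᵘ i)) (λ i → sum (tᵍ i)) ⟨
      sum (λ i → sum (tᵘ i) ℤ.+ sum (tᵍ i))
        ≡⟨ ∑-cong (suc n) (λ i → ∑-distrib-+ (tᵘ i) (tᵍ i)) ⟨
      sum (λ i → sum (λ j → tᵘ i j ℤ.+ tᵍ i j))
        ≡⟨ ∑-cong (suc n) (λ i → ∑-cong (suc k) λ j → trans
             (sym (ℤ.*-distribʳ-+ (f (n ∸ toℕ i) (k ∸ toℕ j)) (u (toℕ i) (toℕ j)) _))
             (cong (λ c → c ℤ.* _) (u+g≡1 (toℕ i) (toℕ j)))) ⟩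
      (1# * f) n k ∎
      where
      tᵘ tᵍ : Fin (suc n) → Fin (suc k) → ℤ
      tᵘ i j = u (toℕ i) (toℕ j) ℤ.* f (n ∸ toℕ i) (k ∸ toℕ j)
      tᵍ i j = g (toℕ i) (toℕ j) ℤ.* f (n ∸ toℕ i) (k ∸ toℕ j)

  ⁻¹-inverseʳ : g * g ⁻¹ ≈ 1#
  ⁻¹-inverseʳ n k = ∙-cancelˡ ((u * g ⁻¹) n k) _ _ (begin
    (u * g ⁻¹) n k ℤ.+ (g * g ⁻¹) n k ≡⟨ *-distribʳ (g ⁻¹) n k ⟩
    (1# * g ⁻¹) n k                   ≡⟨ *-identityˡ (g ⁻¹) n k ⟩
    (g ⁻¹) n k                        ≡⟨ ⁻¹-unfold n k ⟩
    1# n k ℤ.+ (u * g ⁻¹) n k         ≡⟨ ℤ.+-comm (1# n k) _ ⟩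
    (u * g ⁻¹) n k ℤ.+ 1# n k         ∎)

∑-syntax : (n : ℕ) → (ℕ → Series) → Series
∑-syntax n f = sumSeries {n} (f ∘ toℕ)

infixl 5 ∑-syntax
syntax ∑-syntax n (λ j → e) = ∑[ j < n ] e

F : List ℕ → Series
F a n k = ℤ.+ p n k ((1 ∷ 1 ∷ 2 ∷ []) ∷ τ₁₁₂ a ∷ [])

{-# OPTIONS --safe #-}

-- A partition with k blocks avoids 112 iff it is 12⋯k followed by a weakly
-- decreasing word over [k], so these partitions are the τ₁₁₂(b) for b a composition with
-- k parts, and τ₁₁₂(b) contains τ₁₁₂(a) iff some subsequence of b dominates a
-- termwise. Let G_a count the compositions that avoid a in this sense.
-- Matching a greedily and splitting off the first part of b gives
--   (1 - x(1+y) + x^{a₁} y) G_a = 1 - x + x^{a₁} y G_{a₂⋯a_ℓ},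
-- with G = 0 for the empty pattern, and iterating this yields the sum.

module Submission where

open import Algebra.Bundles using (CommutativeMonoid; CommutativeRing)
import Algebra.Construct.Pointwise as Pointwise
open import Algebra.Morphism.Structures using (IsRingMonomorphism)
import Algebra.Morphism.RingMonomorphism as RingMonomorphism
import Algebra.Properties.CommutativeSemigroup as CommutativeSemigroupProperties
import Algebra.Properties.Group as GroupProperties
import Algebra.Properties.Semiring.Exp as SemiringExp
import Algebra.Properties.Semiring.Sum as SemiringSum
import Algebra.Solver.Ring.NaturalCoefficients.Default as NaturalCoefficientsSolver
open import Data.Bool.Base using (true; false)
open import Data.Empty using (⊥)
open import Data.Fin.Base as Fin using (Fin; toℕ; zero; suc)
import Data.Fin.Properties as Fin
open import Data.Integer.Base as ℤ using (ℤ; 0ℤ; 1ℤ)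
import Data.Integer.Properties as ℤ
open import Data.List.Base as List
  using (List; []; _∷_; length; map; take; drop; _++_; filter; lookup; upTo;
    replicate; tabulate; reverse; concatMap; allFin)
open import Data.List.Extrema.Nat using (max; max≤v⁺; v≤max⁺)
open import Data.List.Membership.Propositional using (_∈_; _∉_)
open import Data.List.Membership.Propositional.Properties
  using (∈-map⁺; ∈-map⁻; ∈-++⁺ˡ; ∈-++⁺ʳ; ∈-++⁻; ∈-upTo⁺; ∈-upTo⁻; ∈-lookup;
    ∈-filter⁺; ∈-filter⁻; ∈-cartesianProductWith⁺; ∈-cartesianProductWith⁻)
open import Data.List.Membership.Propositional.Properties.WithK using (unique∧set⇒bag)
open import Data.List.Properties
open import Data.List.Relation.Binary.Sublist.Heterogeneous as Sublist
  using (Sublist; []; _∷_; _∷ʳ_; minimum)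
import Data.List.Relation.Binary.Sublist.Heterogeneous.Properties as Sublist
open import Data.List.Relation.Binary.BagAndSetEquality using (∼bag⇒↭)
open import Data.List.Relation.Binary.Permutation.Propositional.Properties using (↭-length)
open import Data.List.Relation.Binary.Sublist.Propositional using (_⊆_; ⊆-refl)
open import Data.List.Relation.Unary.All as All using (All; []; _∷_)
import Data.List.Relation.Unary.All.Properties as All
open import Data.List.Relation.Unary.AllPairs as AllPairs using (AllPairs; []; _∷_)
import Data.List.Relation.Unary.AllPairs.Properties as AllPairs
open import Data.List.Relation.Unary.Any as Any using (here; there)
import Data.List.Relation.Unary.Any.Properties as Any
open import Data.List.Relation.Unary.Unique.Propositional using (Unique)
import Data.List.Relation.Unary.Unique.Propositional.Properties as Unique
open import Data.Nat.Base as ℕ using (ℕ; zero; suc; _≤_; _<_; _∸_; z≤n; s≤s; pred)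
open import Data.Nat.ListAction using (sum)
import Data.Nat.Properties as ℕ
open import Data.List.Membership.DecPropositional ℕ._≟_ using (_∈?_)
open import Data.Product.Base using (∃; _×_; _,_; proj₁; proj₂)
open import Data.Sum.Base using (_⊎_; inj₁; inj₂; [_,_]′)
open import Function.Base using (_∘_; id)
open import Function.Bundles using (mk⇔; Equivalence)
open import Level using (0ℓ)
open import Relation.Binary.Definitions using (tri<; tri≈; tri>)
open import Relation.Binary.PropositionalEquality as ≡ using (_≡_; _≢_; cong; module ≡-Reasoning)
import Relation.Binary.Reasoning.Setoid as SetoidReasoning
open import Relation.Nullary.Decidable using (Dec; yes; no; does; ¬?; _×-dec_; _⊎-dec_)
open import Relation.Nullary.Negation using (¬_; contradiction)
open import Relation.Unary using (Pred; Decidable; _≐_)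

-- Power series

-- An occurrence of a pattern is an increasing relabelling of its letters whose result is a
-- subsequence. Relabelling cannot lower multiplicities, and letter i has multiplicity b_i in
-- τ₁₁₂(b), so containment forces domination along an increasing map of positions. Conversely, such
-- a map relabels the increasing prefix and the decreasing suffix separately.
--
-- Compositions are built one unit at a time: the first part either is 1 or is lowered by 1.
-- Lowering it must also lower what the pattern demands of it, but only in this one comparison; if
-- it falls short, the full a₁ is demanded of the next part. A family of series indexed by the
-- current demand s records this. Iterating over s produces the power x^{a₁} without summing
-- geometric series.
--
-- The series of the statement form only a raw ring with an explicit inverse. The ring laws come
-- from reading them as series in x over series in y; inverses of products are handled through
-- uniqueness of inverses.

module PowerSeries {c ℓ} (R : CommutativeRing c ℓ) where
  open CommutativeRing R renaming (Carrier to A)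
  open CommutativeSemigroupProperties (CommutativeMonoid.commutativeSemigroup +-commutativeMonoid)
    using (interchange)
  open SemiringSum semiring using (sum⁺-syntax)
  open SetoidReasoning setoid

  infix  4 _≋_
  infixl 7 _⋆_

  _≋_ : (ℕ → A) → (ℕ → A) → Set ℓ
  f ≋ g = ∀ n → f n ≈ g n

  -- By computation `(f ⋆ g) (suc n)` is `f 0 * g (suc n) + ((f ∘ suc) ⋆ g) n`. The inductions on
  -- the degree below shift the first factor in this way.
  _⋆_ : (ℕ → A) → (ℕ → A) → ℕ → A
  (f ⋆ g) n = ∑[ i ≤ n ] (f (toℕ i) * g (n ∸ toℕ i))

  one : ℕ → A
  one zero    = 1#
  one (suc n) = 0#

  ⋆-cong : ∀ {f f′ g g′} → f ≋ f′ → g ≋ g′ → f ⋆ g ≋ f′ ⋆ g′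
  ⋆-cong p q zero    = +-congʳ (*-cong (p 0) (q 0))
  ⋆-cong p q (suc n) = +-cong (*-cong (p 0) (q (suc n))) (⋆-cong (p ∘ suc) q n)

  zeroˡ⋆ : ∀ g n → ((λ _ → 0#) ⋆ g) n ≈ 0#
  zeroˡ⋆ g zero    = trans (+-identityʳ _) (zeroˡ _)
  zeroˡ⋆ g (suc n) = trans (+-cong (zeroˡ _) (zeroˡ⋆ g n)) (+-identityʳ _)

  ⋆-identityˡ : ∀ g → one ⋆ g ≋ g
  ⋆-identityˡ g zero    = trans (+-identityʳ _) (*-identityˡ _)
  ⋆-identityˡ g (suc n) = trans (+-cong (*-identityˡ _) (zeroˡ⋆ g n)) (+-identityʳ _)

  ⋆-distribʳ : ∀ h f g → (λ n → f n + g n) ⋆ h ≋ λ n → (f ⋆ h) n + (g ⋆ h) n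
  ⋆-distribʳ h f g zero    = begin
    (f 0 + g 0) * h 0 + 0#              ≈⟨ +-identityʳ _ ⟩
    (f 0 + g 0) * h 0                   ≈⟨ distribʳ _ _ _ ⟩
    f 0 * h 0 + g 0 * h 0               ≈⟨ +-cong (+-identityʳ _) (+-identityʳ _) ⟨
    (f 0 * h 0 + 0#) + (g 0 * h 0 + 0#) ∎
  ⋆-distribʳ h f g (suc n) = begin
    (f 0 + g 0) * h (suc n) + ((λ i → f (suc i) + g (suc i)) ⋆ h) n
      ≈⟨ +-cong (distribʳ _ _ _) (⋆-distribʳ h (f ∘ suc) (g ∘ suc) n) ⟩
    (f 0 * h (suc n) + g 0 * h (suc n)) + (((f ∘ suc) ⋆ h) n + ((g ∘ suc) ⋆ h) n)
      ≈⟨ interchange _ _ _ _ ⟩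
    (f 0 * h (suc n) + ((f ∘ suc) ⋆ h) n) + (g 0 * h (suc n) + ((g ∘ suc) ⋆ h) n) ∎

  -- Peeling off the first term is definitional; commutativity also needs the mirror image, with the
  -- last term peeled off.
  ⋆-snoc : ∀ f g n → (f ⋆ g) (suc n) ≈ (f ⋆ (g ∘ suc)) n + f (suc n) * g 0
  ⋆-snoc f g zero    = begin
    f 0 * g 1 + (f 1 * g 0 + 0#) ≈⟨ +-congˡ (+-identityʳ _) ⟩
    f 0 * g 1 + f 1 * g 0        ≈⟨ +-congʳ (+-identityʳ _) ⟨
    (f 0 * g 1 + 0#) + f 1 * g 0 ∎
  ⋆-snoc f g (suc n) = trans (+-congˡ (⋆-snoc (f ∘ suc) g n)) (sym (+-assoc _ _ _))

  ⋆-comm : ∀ f g → f ⋆ g ≋ g ⋆ f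
  ⋆-comm f g zero    = +-congʳ (*-comm _ _)
  ⋆-comm f g (suc n) = begin
    f 0 * g (suc n) + ((f ∘ suc) ⋆ g) n ≈⟨ +-cong (*-comm _ _) (⋆-comm (f ∘ suc) g n) ⟩
    g (suc n) * f 0 + (g ⋆ (f ∘ suc)) n ≈⟨ +-comm _ _ ⟩
    (g ⋆ (f ∘ suc)) n + g (suc n) * f 0 ≈⟨ ⋆-snoc g f n ⟨
    (g ⋆ f) (suc n)                     ∎

  ⋆-scale : ∀ c f g n → ((λ i → c * f i) ⋆ g) n ≈ c * (f ⋆ g) n
  ⋆-scale c f g zero    = begin
    (c * f 0) * g 0 + 0# ≈⟨ +-cong (*-assoc _ _ _) (sym (zeroʳ c)) ⟩
    c * (f 0 * g 0) + c * 0# ≈⟨ distribˡ _ _ _ ⟨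
    c * (f 0 * g 0 + 0#) ∎
  ⋆-scale c f g (suc n) =
    trans (+-cong (*-assoc _ _ _) (⋆-scale c (f ∘ suc) g n)) (sym (distribˡ _ _ _))

  ⋆-assoc : ∀ f g h → (f ⋆ g) ⋆ h ≋ f ⋆ (g ⋆ h)
  ⋆-assoc f g h zero    = +-congʳ (begin
    (f 0 * g 0 + 0#) * h 0 ≈⟨ *-congʳ (+-identityʳ _) ⟩
    (f 0 * g 0) * h 0      ≈⟨ *-assoc _ _ _ ⟩
    f 0 * (g 0 * h 0)      ≈⟨ *-congˡ (+-identityʳ _) ⟨
    f 0 * (g 0 * h 0 + 0#) ∎)
  ⋆-assoc f g h (suc n) = begin
    (f 0 * g 0 + 0#) * h (suc n) + ((λ i → f 0 * g (suc i) + ((f ∘ suc) ⋆ g) i) ⋆ h) n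
      ≈⟨ +-cong (trans (*-congʳ (+-identityʳ _)) (*-assoc _ _ _))
           (⋆-distribʳ h (λ i → f 0 * g (suc i)) ((f ∘ suc) ⋆ g) n) ⟩
    f 0 * (g 0 * h (suc n)) + (((λ i → f 0 * g (suc i)) ⋆ h) n + (((f ∘ suc) ⋆ g) ⋆ h) n)
      ≈⟨ +-congˡ (+-cong (⋆-scale (f 0) (g ∘ suc) h n) (⋆-assoc (f ∘ suc) g h n)) ⟩
    f 0 * (g 0 * h (suc n)) + (f 0 * ((g ∘ suc) ⋆ h) n + ((f ∘ suc) ⋆ (g ⋆ h)) n)
      ≈⟨ +-assoc _ _ _ ⟨
    (f 0 * (g 0 * h (suc n)) + f 0 * ((g ∘ suc) ⋆ h) n) + ((f ∘ suc) ⋆ (g ⋆ h)) n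
      ≈⟨ +-congʳ (distribˡ _ _ _) ⟨
    f 0 * (g ⋆ h) (suc n) + ((f ∘ suc) ⋆ (g ⋆ h)) n ∎

  constant-⋆ : ∀ f g → (∀ n → f (suc n) ≈ 0#) → ∀ n → (f ⋆ g) n ≈ f 0 * g n
  constant-⋆ f g f≈0 zero    = +-identityʳ _
  constant-⋆ f g f≈0 (suc n) = trans
    (+-congˡ (trans (⋆-cong {g = g} {g} f≈0 (λ _ → refl) n) (zeroˡ⋆ g n))) (+-identityʳ _)

  shift-zero : ∀ f g → f 0 ≈ 0# → (f ⋆ g) 0 ≈ 0#
  shift-zero f g f₀≈0 = trans (+-identityʳ _) (trans (*-congʳ f₀≈0) (zeroˡ _))

  shift-suc : ∀ f g → f 0 ≈ 0# → f ∘ suc ≋ one → ∀ n → (f ⋆ g) (suc n) ≈ g n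
  shift-suc f g f₀≈0 f≋x n = trans
    (+-cong (trans (*-congʳ f₀≈0) (zeroˡ _))
      (trans (⋆-cong {g = g} {g} f≋x (λ _ → refl) n) (⋆-identityˡ g n)))
    (+-identityˡ _)

  commutativeRing : CommutativeRing c ℓ
  commutativeRing = record
    { Carrier = ℕ → A
    ; _≈_ = _≋_
    ; _+_ = λ f g n → f n + g n
    ; _*_ = _⋆_
    ; -_ = λ f n → - f n
    ; 0# = λ _ → 0#
    ; 1# = one
    ; isCommutativeRing = record
      { isRing = record
        { +-isAbelianGroup = Pointwise.isAbelianGroup ℕ +-isAbelianGroup
        ; *-cong = ⋆-cong
        ; *-assoc = ⋆-assoc
        ; *-identity = ⋆-identityˡ , λ f n → trans (⋆-comm f one n) (⋆-identityˡ f n)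
        ; distrib = (λ h f g n → trans (⋆-comm h (λ i → f i + g i) n) (trans (⋆-distribʳ h f g n)
                       (+-cong (⋆-comm f h n) (⋆-comm g h n))))
                  , ⋆-distribʳ
        }
      ; *-comm = ⋆-comm
      }
    }

-- Subtraction-free recurrences and their solution in a commutative ring

module RingIdentities {c ℓ} (R : CommutativeRing c ℓ) where
  open CommutativeRing R hiding (zero) renaming (Carrier to A)
  open GroupProperties +-group using () renaming (∙-cancelʳ to +-cancelʳ)
  open SemiringExp semiring using (_^_; ^-homo-*)
  open SemiringSum semiring using (*-distribˡ-sum; sum-cong-≋) renaming (sum to sumᴿ)
  open NaturalCoefficientsSolver commutativeSemiring
  open SetoidReasoning setoid

  -- C s counts the compositions whose first part is compared with s + 1
  -- instead of the first part of the pattern; x is added to both sides of its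
  -- recurrence so that no subtraction occurs.
  threshold : ∀ x y c c′ (C : ℕ → A) →
    C 0 + x ≈ 1# + x * y * c′ + x * C 0 →
    (∀ s → C (suc s) + x ≈ 1# + x * y * c + x * C s) →
    ∀ s → C s + x ^ suc s * y * c + x ≈
          1# + x * y * c + x ^ suc s * y * c′ + x * C s
  threshold x y c c′ C base step zero = begin
    C 0 + x * 1# * y * c + x
      ≈⟨ solve 4 (λ x y c C₀ → C₀ :+ x :* con 1 :* y :* c :+ x := (C₀ :+ x) :+ x :* y :* c)
           refl x y c (C 0) ⟩
    (C 0 + x) + x * y * c
      ≈⟨ +-congʳ base ⟩
    (1# + x * y * c′ + x * C 0) + x * y * c
      ≈⟨ solve 5 (λ x y c c′ C₀ → (con 1 :+ x :* y :* c′ :+ x :* C₀) :+ x :* y :* c :=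
             con 1 :+ x :* y :* c :+ x :* con 1 :* y :* c′ :+ x :* C₀)
           refl x y c c′ (C 0) ⟩
    1# + x * y * c + x * 1# * y * c′ + x * C 0 ∎
  -- The extra `x * x` is `x` times the summand `x` of the induction hypothesis; the second use of
  -- `step` returns it.
  threshold x y c c′ C base step (suc s) = +-cancelʳ (x * x) _ _ (begin
    (C (suc s) + x * z * y * c + x) + x * x
      ≈⟨ solve 5 (λ x y z c C₁ → (C₁ :+ x :* z :* y :* c :+ x) :+ x :* x :=
             (C₁ :+ x) :+ (x :* z :* y :* c :+ x :* x)) refl x y z c (C (suc s)) ⟩
    (C (suc s) + x) + (x * z * y * c + x * x)
      ≈⟨ +-congʳ (step s) ⟩
    (1# + x * y * c + x * C s) + (x * z * y * c + x * x)
      ≈⟨ solve 5 (λ x y z c C₀ →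
             (con 1 :+ x :* y :* c :+ x :* C₀) :+ (x :* z :* y :* c :+ x :* x) :=
             con 1 :+ x :* y :* c :+ x :* (C₀ :+ z :* y :* c :+ x)) refl x y z c (C s) ⟩
    1# + x * y * c + x * (C s + z * y * c + x)
      ≈⟨ +-congˡ (*-congˡ (threshold x y c c′ C base step s)) ⟩
    1# + x * y * c + x * (1# + x * y * c + z * y * c′ + x * C s)
      ≈⟨ solve 6 (λ x y z c c′ C₀ →
             con 1 :+ x :* y :* c :+ x :* (con 1 :+ x :* y :* c :+ z :* y :* c′ :+ x :* C₀) :=
             con 1 :+ x :* y :* c :+ x :* z :* y :* c′ :+ x :* (con 1 :+ x :* y :* c :+ x :* C₀))
           refl x y z c c′ (C s) ⟩
    1# + x * y * c + x * z * y * c′ + x * (1# + x * y * c + x * C s)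
      ≈⟨ +-congˡ (*-congˡ (step s)) ⟨
    1# + x * y * c + x * z * y * c′ + x * (C (suc s) + x)
      ≈⟨ solve 6 (λ x y z c c′ C₁ →
             con 1 :+ x :* y :* c :+ x :* z :* y :* c′ :+ x :* (C₁ :+ x) :=
             (con 1 :+ x :* y :* c :+ x :* z :* y :* c′ :+ x :* C₁) :+ x :* x)
           refl x y z c c′ (C (suc s)) ⟩
    (1# + x * y * c + x * z * y * c′ + x * C (suc s)) + x * x ∎)
    where z = x ^ suc s

  -- Adding `x * (1# + y) * c + x` removes both negative terms. The solver works over semirings, so
  -- negatives enter it as opaque variables and are cancelled by hand.
  subtractive-form : ∀ x y z c c′ →
    c + z * y * c + x ≈ 1# + x * y * c + z * y * c′ + x * c →
    (1# + - (x * (1# + y)) + z * y) * c ≈ 1# + - x + z * y * c′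
  subtractive-form x y z c c′ eq = +-cancelʳ (x * (1# + y) * c + x) _ _ (begin
    (1# + - u + z * y) * c + (u * c + x)
      ≈⟨ solve 6 (λ x y z c u n → (con 1 :+ n :+ z :* y) :* c :+ (u :* c :+ x) :=
             (c :+ z :* y :* c :+ x) :+ (n :+ u) :* c) refl x y z c u (- u) ⟩
    (c + z * y * c + x) + (- u + u) * c
      ≈⟨ +-cong eq (trans (*-congʳ (-‿inverseˡ u)) (zeroˡ c)) ⟩
    (1# + x * y * c + z * y * c′ + x * c) + 0#
      ≈⟨ +-congˡ (-‿inverseˡ x) ⟨
    (1# + x * y * c + z * y * c′ + x * c) + (- x + x)
      ≈⟨ solve 6 (λ x y z c c′ n →
             (con 1 :+ x :* y :* c :+ z :* y :* c′ :+ x :* c) :+ (n :+ x) :=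
             (con 1 :+ n :+ z :* y :* c′) :+ (x :* (con 1 :+ y) :* c :+ x))
           refl x y z c c′ (- x) ⟩
    (1# + - x + z * y * c′) + (u * c + x) ∎)
    where u = x * (1# + y)

  inverse-unique : ∀ {d e e′} → d * e ≈ 1# → d * e′ ≈ 1# → e ≈ e′
  inverse-unique {d} {e} {e′} de de′ = begin
    e            ≈⟨ *-identityʳ e ⟨
    e * 1#       ≈⟨ *-congˡ de′ ⟨
    e * (d * e′) ≈⟨ solve 3 (λ d e e′ → e :* (d :* e′) := d :* e :* e′) refl d e e′ ⟩
    d * e * e′   ≈⟨ *-congʳ de ⟩
    1# * e′      ≈⟨ *-identityˡ e′ ⟩
    e′           ∎

  inverse-product : ∀ {d e p q} → d * e ≈ 1# → p * q ≈ 1# → (d * p) * (e * q) ≈ 1#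
  inverse-product {d} {e} {p} {q} de pq = begin
    (d * p) * (e * q) ≈⟨ solve 4 (λ d e p q → (d :* p) :* (e :* q) := (d :* e) :* (p :* q))
                           refl d e p q ⟩
    (d * e) * (p * q) ≈⟨ *-cong de pq ⟩
    1# * 1#           ≈⟨ *-identityˡ 1# ⟩
    1#                ∎

  divide : ∀ {d e f g} → d * e ≈ 1# → d * f ≈ g → f ≈ e * g
  divide {d} {e} {f} {g} de df = begin
    f           ≈⟨ *-identityˡ f ⟨
    1# * f      ≈⟨ *-congʳ de ⟨
    d * e * f   ≈⟨ solve 3 (λ d e f → d :* e :* f := e :* (d :* f)) refl d e f ⟩
    e * (d * f) ≈⟨ *-congˡ df ⟩
    e * g       ∎

  -- Dividing the recurrence by the first denominator, with inverse `e`, contributes `e * w` and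
  -- multiplies every summand for the shorter pattern by `e * z`.
  sum-recurrence : ∀ {n} (t : Fin (suc n) → A) (t′ : Fin n → A) e z w →
    t zero ≈ e * w → (∀ i → t (suc i) ≈ (e * z) * t′ i) →
    sumᴿ t ≈ e * (w + z * sumᴿ t′)
  sum-recurrence {n} t t′ e z w head tail = begin
    t zero + sumᴿ (t ∘ suc)                  ≈⟨ +-cong head (sum-cong-≋ tail) ⟩
    e * w + sumᴿ (λ i → (e * z) * t′ i)      ≈⟨ +-congˡ (*-distribˡ-sum (e * z) t′) ⟨
    e * w + (e * z) * sumᴿ t′                ≈⟨ +-congˡ (*-assoc e z (sumᴿ t′)) ⟩
    e * w + e * (z * sumᴿ t′)                ≈⟨ distribˡ e w (z * sumᴿ t′) ⟨
    e * (w + z * sumᴿ t′)                    ∎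

  first-term : ∀ {e q} w → q ≈ e → 1# * 1# * w * q ≈ e * w
  first-term {e} {q} w q≈e = begin
    1# * 1# * w * q ≈⟨ solve 2 (λ w q → con 1 :* con 1 :* w :* q := q :* w) refl w q ⟩
    q * w           ≈⟨ *-congʳ q≈e ⟩
    e * w           ∎

  later-term : ∀ {e p q} x y m s j w → q ≈ e * p →
    x ^ (m ℕ.+ s) * y ^ suc j * w * q ≈ (e * (x ^ m * y)) * (x ^ s * y ^ j * w * p)
  later-term {e} {p} {q} x y m s j w q≈ep = begin
    x ^ (m ℕ.+ s) * (y * y ^ j) * w * q
      ≈⟨ *-cong (*-congʳ (*-congʳ (^-homo-* x m s))) q≈ep ⟩
    x ^ m * x ^ s * (y * y ^ j) * w * (e * p)
      ≈⟨ solve 7 (λ xm xs y yj w e p → xm :* xs :* (y :* yj) :* w :* (e :* p) :=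
             (e :* (xm :* y)) :* (xs :* yj :* w :* p)) refl (x ^ m) (x ^ s) y (y ^ j) w e p ⟩
    (e * (x ^ m * y)) * (x ^ s * y ^ j * w * p) ∎

  module _ (x y w : A) (D : ℕ → A) (inv : A → A) where

    ∏ᴿ : List ℕ → A
    ∏ᴿ a = List.foldr _*_ 1# (map D a)

    summand : List ℕ → ℕ → A
    summand a j = x ^ sum (take j a) * y ^ j * w * inv (∏ᴿ (take (suc j) a))

    -- Induction on the pattern. `inv` is known only as an inverse on the products `∏ᴿ`, so the
    -- inverse of a longer product is split by uniqueness of inverses.
    solve-recurrence : (∀ a → ∏ᴿ a * inv (∏ᴿ a) ≈ 1#) →
      (G : List ℕ → A) → G [] ≈ 0# →
      (∀ m a → D (suc m) * G (suc m ∷ a) ≈ w + x ^ suc m * y * G a) →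
      ∀ a → All (1 ≤_) a → G a ≈ sumᴿ {length a} (λ i → summand a (toℕ i))
    solve-recurrence ∏-inverse G G[] G∷ []          []          = G[]
    solve-recurrence ∏-inverse G G[] G∷ (suc n ∷ a) (_ ∷ a≥1) = begin
      G (m ∷ a)
        ≈⟨ divide De (G∷ n a) ⟩
      e * (w + x ^ m * y * G a)
        ≈⟨ *-congˡ (+-congˡ (*-congˡ (solve-recurrence ∏-inverse G G[] G∷ a a≥1))) ⟩
      e * (w + x ^ m * y * sumᴿ {length a} (λ i → summand a (toℕ i)))
        ≈⟨ sum-recurrence {length a} (λ i → summand (m ∷ a) (toℕ i)) (λ i → summand a (toℕ i))
             e (x ^ m * y) w
             (first-term w refl)
             (λ i → later-term x y m (sum (take (toℕ i) a)) (toℕ i) w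
               (inverse-unique (∏-inverse (m ∷ take (suc (toℕ i)) a))
                 (inverse-product De (∏-inverse (take (suc (toℕ i)) a))))) ⟨
      sumᴿ {suc (length a)} (λ i → summand (m ∷ a) (toℕ i)) ∎
      where
      m : ℕ
      m = suc n
      e : A
      -- `D m * 1#` is `∏ᴿ (m ∷ [])`, which is also the denominator of the summand with index 0.
      e = inv (D m * 1#)
      De : D m * e ≈ 1#
      De = trans (*-congʳ (sym (*-identityʳ (D m)))) (∏-inverse (m ∷ []))

open import Defs

-- Series in two variables as iterated power series

module ℤ⟦Y⟧ = PowerSeries ℤ.+-*-commutativeRing
module ℤ⟦Y⟧⟦X⟧ = PowerSeries ℤ⟦Y⟧.commutativeRing

open SemiringSum (CommutativeRing.semiring ℤ⟦Y⟧.commutativeRing) using () renaming (sum to sumʸ)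
open SemiringSum ℤ.+-*-semiring using () renaming (sum to sumᶻ)

sum-coefficient : ∀ n (f : Fin n → ℕ → ℤ) k → sumʸ f k ≡ sumᶻ (λ i → f i k)
sum-coefficient zero    f k = ≡.refl
sum-coefficient (suc n) f k = ≡.cong (ℤ._+_ (f zero k)) (sum-coefficient n (f ∘ suc) k)

one-coefficient : ∀ n k → 1# n k ≡ ℤ⟦Y⟧⟦X⟧.one n k
one-coefficient zero    zero    = ≡.refl
one-coefficient zero    (suc k) = ≡.refl
one-coefficient (suc n) zero    = ≡.refl
one-coefficient (suc n) (suc k) = ≡.refl

*-coefficient : ∀ f g n k → (f * g) n k ≡ ℤ⟦Y⟧⟦X⟧._⋆_ f g n k
*-coefficient f g n k = ≡.sym (sum-coefficient (suc n)
  (λ i → ℤ⟦Y⟧._⋆_ (f (toℕ i)) (g (n ∸ toℕ i))) k)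

-- The map is the identity; only the product and the unit are defined differently on the two sides.
-- All ring laws can then be pulled back.
coefficients-isRingMonomorphism : IsRingMonomorphism ℤ⟦x,y⟧
  (CommutativeRing.rawRing ℤ⟦Y⟧⟦X⟧.commutativeRing) (λ f → f)
coefficients-isRingMonomorphism = record
  { isRingHomomorphism = record
    { isSemiringHomomorphism = record
      { isNearSemiringHomomorphism = record
        { +-isMonoidHomomorphism = record
          { isMagmaHomomorphism = record
            { isRelHomomorphism = record { cong = λ p → p }
            ; homo = λ f g n k → ≡.refl
            }
          ; ε-homo = λ n k → ≡.refl
          }
        ; *-homo = *-coefficient
        }
      ; 1#-homo = one-coefficient
      }
    ; -‿homo = λ f n k → ≡.refl
    }
  ; injective = λ p → p
  }

series-commutativeRing : CommutativeRing 0ℓ 0ℓ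
series-commutativeRing = record
  { isCommutativeRing = RingMonomorphism.isCommutativeRing coefficients-isRingMonomorphism
      (CommutativeRing.isCommutativeRing ℤ⟦Y⟧⟦X⟧.commutativeRing)
  }

X*-zero : ∀ f k → (X * f) 0 k ≡ 0ℤ
X*-zero f k = ≡.trans (*-coefficient X f 0 k) (ℤ⟦Y⟧⟦X⟧.shift-zero X f (λ _ → ≡.refl) k)

X*-suc : ∀ f n k → (X * f) (suc n) k ≡ f n k
X*-suc f n k = ≡.trans (*-coefficient X f (suc n) k)
  (ℤ⟦Y⟧⟦X⟧.shift-suc X f (λ _ → ≡.refl) X∘suc n k)
  where
  X∘suc : ∀ n k → X (suc n) k ≡ ℤ⟦Y⟧⟦X⟧.one n k
  X∘suc zero    zero    = ≡.refl
  X∘suc zero    (suc k) = ≡.refl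
  X∘suc (suc n) k       = ≡.refl

private
  -- As a series in x over series in y, `Y` is constant, so it acts on each row separately.
  Y*-row : ∀ f n k → (Y * f) n k ≡ ℤ⟦Y⟧._⋆_ (Y 0) (f n) k
  Y*-row f n k = ≡.trans (*-coefficient Y f n k)
    (ℤ⟦Y⟧⟦X⟧.constant-⋆ Y f (λ _ _ → ≡.refl) n k)

Y*-zero : ∀ f n → (Y * f) n 0 ≡ 0ℤ
Y*-zero f n = ≡.trans (Y*-row f n 0) (ℤ⟦Y⟧.shift-zero (Y 0) (f n) ≡.refl)

Y*-suc : ∀ f n k → (Y * f) n (suc k) ≡ f n k
Y*-suc f n k = ≡.trans (Y*-row f n (suc k)) (ℤ⟦Y⟧.shift-suc (Y 0) (f n) ≡.refl Y₀∘suc k)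
  where
  Y₀∘suc : ∀ k → Y 0 (suc k) ≡ ℤ⟦Y⟧.one k
  Y₀∘suc zero    = ≡.refl
  Y₀∘suc (suc k) = ≡.refl

private
  module S = CommutativeRing series-commutativeRing

open RingIdentities series-commutativeRing

-- Denominators and their inverses

denominator : ℕ → Series
denominator m = 1# - X * (1# + Y) + X ^ m * Y

product-constant-term : ∀ f g → f 0 0 ≡ 1ℤ → g 0 0 ≡ 1ℤ → (f * g) 0 0 ≡ 1ℤ
product-constant-term f g p q rewrite p | q = ≡.refl

-- For every `m` the last summand has no constant term, because `Y` has none.
denominator-constant-term : ∀ m → denominator m 0 0 ≡ 1ℤ
denominator-constant-term m rewrite ℤ.*-zeroʳ ((X ^ m) 0 0) = ≡.refl

∏-constant-term : ∀ a → ∏ (map denominator a) 0 0 ≡ 1ℤ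
∏-constant-term []      = ≡.refl
∏-constant-term (m ∷ a) =
  product-constant-term (denominator m) (∏ (map denominator a))
    (denominator-constant-term m) (∏-constant-term a)

∏-inverse : ∀ a → ∏ (map denominator a) * ∏ (map denominator a) ⁻¹ ≈ 1#
∏-inverse a = ⁻¹-inverseʳ (∏ (map denominator a)) (∏-constant-term a)

rational-form : (G : List ℕ → Series) → G [] ≈ 0# →
  (∀ m a → denominator (suc m) * G (suc m ∷ a) ≈ 1# - X + X ^ suc m * Y * G a) →
  ∀ a → All (1 ≤_) a → G a ≈ ∑[ j < length a ]
    (X ^ sum (take j a) * Y ^ j * (1# - X) / ∏ (map denominator (take (suc j) a)))
rational-form G = solve-recurrence X Y (1# - X) denominator _⁻¹ ∏-inverse G

-- Counting compositions

private
  variable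
    A B : Set

infix 4 _⊑_ _⊑?_

_⊑_ : List ℕ → List ℕ → Set
_⊑_ = Sublist _≤_

_⊑?_ : ∀ a b → Dec (a ⊑ b)
_⊑?_ = Sublist.sublist? ℕ._≤?_

count : {P : Pred A 0ℓ} → Decidable P → List A → ℕ
count P? xs = length (filter P? xs)

count-map : ∀ {P : Pred B 0ℓ} (P? : Decidable P) (f : A → B) xs →
  count P? (map f xs) ≡ count (λ x → P? (f x)) xs
count-map P? f []       = ≡.refl
count-map P? f (x ∷ xs) with does (P? (f x))
... | true  = cong suc (count-map P? f xs)
... | false = count-map P? f xs

count-++ : ∀ {P : Pred A 0ℓ} (P? : Decidable P) xs ys →
  count P? (xs ++ ys) ≡ count P? xs ℕ.+ count P? ys
count-++ P? xs ys = ≡.trans (cong length (filter-++ P? xs ys)) (length-++ (filter P? xs))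

count-¬-≐ : ∀ {P Q : Pred A 0ℓ} (P? : Decidable P) (Q? : Decidable Q) → P ≐ Q →
  ∀ xs → count (λ x → ¬? (P? x)) xs ≡ count (λ x → ¬? (Q? x)) xs
count-¬-≐ P? Q? (P⊆Q , Q⊆P) xs = cong length
  (filter-≐ (λ x → ¬? (P? x)) (λ x → ¬? (Q? x))
    ((λ ¬p q → ¬p (Q⊆P q)) , (λ ¬q p → ¬q (P⊆Q p))) xs)

-- In `compositions` this meets only lists with at least one part; the value at `[]` keeps it
-- injective.
increment : List ℕ → List ℕ
increment []      = []
increment (y ∷ b) = suc y ∷ b

-- A composition is represented by the list of its parts minus one.
compositions : ℕ → ℕ → List (List ℕ)
compositions zero    zero    = [] ∷ []
compositions zero    (suc k) = []
compositions (suc n) zero    = []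
compositions (suc n) (suc k) =
  map (0 ∷_) (compositions n k) ++ map increment (compositions n (suc k))

-- Greedy matching of the first part

module _ (m : ℕ) (a : List ℕ) where

  -- An occurrence of m ∷ a in which the first part is compared with s instead of m.
  Occurs : ℕ → List ℕ → Set
  Occurs s []      = ⊥
  Occurs s (y ∷ b) = (s ≤ y × a ⊑ b) ⊎ (m ∷ a ⊑ b)

  occurs? : ∀ s → Decidable (Occurs s)
  occurs? s []      = no id
  occurs? s (y ∷ b) = (s ℕ.≤? y ×-dec a ⊑? b) ⊎-dec (m ∷ a ⊑? b)

  occurs-≐ : Occurs m ≐ (m ∷ a ⊑_)
  occurs-≐ = to , from
    where
    to : ∀ {b} → Occurs m b → m ∷ a ⊑ b
    to {y ∷ b} (inj₁ (m≤y , a⊑b)) = m≤y ∷ a⊑b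
    to {y ∷ b} (inj₂ ma⊑b)        = y ∷ʳ ma⊑b
    from : ∀ {b} → m ∷ a ⊑ b → Occurs m b
    from (y ∷ʳ ma⊑b)  = inj₂ ma⊑b
    from (m≤y ∷ a⊑b) = inj₁ (m≤y , a⊑b)

  -- The greedy choice: any first part meets the threshold 0, and using it loses nothing, since a
  -- later match of `m ∷ a` contains one of `a`.
  occurs-zero-∷ : (λ b → Occurs 0 (0 ∷ b)) ≐ (a ⊑_)
  occurs-zero-∷ = [ proj₂ , Sublist.∷ˡ⁻ ]′ , λ a⊑b → inj₁ (z≤n , a⊑b)

  -- The first part is too small and must be skipped; after that the full `m` is demanded, so this
  -- case leads out of the threshold family.
  occurs-suc-∷ : ∀ s → (λ b → Occurs (suc s) (0 ∷ b)) ≐ (m ∷ a ⊑_)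
  occurs-suc-∷ s = (λ { (inj₂ ma⊑b) → ma⊑b }) , inj₂

  -- The threshold 0 cannot drop further, which makes the recurrence for it refer to itself.
  occurs-zero-increment : (λ b → Occurs 0 (increment b)) ≐ Occurs 0
  occurs-zero-increment = (λ {b} → to b) , λ {b} → from b
    where
    to : ∀ b → Occurs 0 (increment b) → Occurs 0 b
    to (y ∷ b) (inj₁ (_ , a⊑b)) = inj₁ (z≤n , a⊑b)
    to (y ∷ b) (inj₂ ma⊑b)      = inj₂ ma⊑b
    from : ∀ b → Occurs 0 b → Occurs 0 (increment b)
    from (y ∷ b) (inj₁ (_ , a⊑b)) = inj₁ (z≤n , a⊑b)
    from (y ∷ b) (inj₂ ma⊑b)      = inj₂ ma⊑b

  occurs-suc-increment : ∀ s → (λ b → Occurs (suc s) (increment b)) ≐ Occurs s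
  occurs-suc-increment s = (λ {b} → to b) , λ {b} → from b
    where
    to : ∀ b → Occurs (suc s) (increment b) → Occurs s b
    to (y ∷ b) (inj₁ (s≤s s≤y , a⊑b)) = inj₁ (s≤y , a⊑b)
    to (y ∷ b) (inj₂ ma⊑b)            = inj₂ ma⊑b
    from : ∀ b → Occurs s b → Occurs (suc s) (increment b)
    from (y ∷ b) (inj₁ (s≤y , a⊑b)) = inj₁ (s≤s s≤y , a⊑b)
    from (y ∷ b) (inj₂ ma⊑b)        = inj₂ ma⊑b

avoiderSeries : List ℕ → Series
avoiderSeries a n k = ℤ.+ count (λ b → ¬? (a ⊑? b)) (compositions n k)

thresholdSeries : ℕ → List ℕ → ℕ → Series
thresholdSeries m a s n k = ℤ.+ count (λ b → ¬? (occurs? m a s b)) (compositions n k)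

count-compositions : ∀ {P Q R : Pred (List ℕ) 0ℓ}
  (P? : Decidable P) (Q? : Decidable Q) (R? : Decidable R) →
  (λ b → P (0 ∷ b)) ≐ Q → (λ b → P (increment b)) ≐ R → ∀ n k →
  ℤ.+ count (λ b → ¬? (P? b)) (compositions (suc n) (suc k)) ≡
  ℤ.+ count (λ b → ¬? (Q? b)) (compositions n k) ℤ.+
  ℤ.+ count (λ b → ¬? (R? b)) (compositions n (suc k))
count-compositions P? Q? R? P∷≐Q P+≐R n k = cong ℤ.+_ (begin
  count ¬P? (map (0 ∷_) bs ++ map increment bs′)
    ≡⟨ count-++ ¬P? (map (0 ∷_) bs) (map increment bs′) ⟩
  count ¬P? (map (0 ∷_) bs) ℕ.+ count ¬P? (map increment bs′)
    ≡⟨ ≡.cong₂ ℕ._+_ (count-map ¬P? (0 ∷_) bs) (count-map ¬P? increment bs′) ⟩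
  count (λ b → ¬P? (0 ∷ b)) bs ℕ.+ count (λ b → ¬P? (increment b)) bs′
    ≡⟨ ≡.cong₂ ℕ._+_ (count-¬-≐ (λ b → P? (0 ∷ b)) Q? P∷≐Q bs)
         (count-¬-≐ (λ b → P? (increment b)) R? P+≐R bs′) ⟩
  count (λ b → ¬? (Q? b)) bs ℕ.+ count (λ b → ¬? (R? b)) bs′ ∎)
  where
  open ≡-Reasoning
  ¬P? = λ b → ¬? (P? b)
  bs  = compositions n k
  bs′ = compositions n (suc k)

-- The term with `g` collects first parts equal to 1, the term with `f` the larger ones. The empty
-- composition has no first part to increase, yet contributes x to `X * f`; the `X` on the left
-- balances it.
recurrence : ∀ (f f′ g : Series) →
  f 0 0 ≡ 1ℤ → (∀ n → f (suc n) 0 ≡ 0ℤ) →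
  f′ 0 0 ≡ 1ℤ → (∀ n → f′ (suc n) 0 ≡ 0ℤ) → (∀ k → f′ 0 (suc k) ≡ 0ℤ) →
  (∀ n k → f′ (suc n) (suc k) ≡ g n k ℤ.+ f n (suc k)) →
  f′ + X ≈ 1# + X * Y * g + X * f
recurrence f f′ g f₀₀ f₀ f′₀₀ f′₀ f′⁰ f′ₛ n k = begin
  f′ n k ℤ.+ X n k                             ≡⟨ go n k ⟩
  1# n k ℤ.+ (X * (Y * g)) n k ℤ.+ (X * f) n k
    ≡⟨ cong (λ z → 1# n k ℤ.+ z ℤ.+ (X * f) n k) (S.*-assoc X Y g n k) ⟨
  1# n k ℤ.+ (X * Y * g) n k ℤ.+ (X * f) n k   ∎
  where
  open ≡-Reasoning
  go : ∀ n k → f′ n k ℤ.+ X n k ≡ 1# n k ℤ.+ (X * (Y * g)) n k ℤ.+ (X * f) n k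
  go zero zero rewrite f′₀₀ | X*-zero (Y * g) 0 | X*-zero f 0 = ≡.refl
  go zero (suc k) rewrite f′⁰ k | X*-zero (Y * g) (suc k) = ≡.refl
  go (suc zero) zero
    rewrite f′₀ 0 | X*-suc (Y * g) 0 0 | Y*-zero g 0 | X*-suc f 0 0 | f₀₀ = ≡.refl
  go (suc (suc n)) zero
    rewrite f′₀ (suc n) | X*-suc (Y * g) (suc n) 0 | Y*-zero g (suc n) | X*-suc f (suc n) 0 | f₀ n
    = ≡.refl
  go (suc n) (suc k)
    rewrite X*-suc (Y * g) n (suc k) | Y*-suc g n k | X*-suc f n (suc k) = begin
    f′ (suc n) (suc k) ℤ.+ X (suc n) (suc k) ≡⟨ cong (ℤ._+_ (f′ (suc n) (suc k))) (X≡0 n) ⟩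
    f′ (suc n) (suc k) ℤ.+ 0ℤ                ≡⟨ ℤ.+-identityʳ _ ⟩
    f′ (suc n) (suc k)                       ≡⟨ f′ₛ n k ⟩
    g n k ℤ.+ f n (suc k)
      ≡⟨ cong (λ z → z ℤ.+ f n (suc k)) (ℤ.+-identityˡ (g n k)) ⟨
    0ℤ ℤ.+ g n k ℤ.+ f n (suc k)             ∎
    where
    X≡0 : ∀ n → X (suc n) (suc k) ≡ 0ℤ
    X≡0 zero    = ≡.refl
    X≡0 (suc n) = ≡.refl

avoiderSeries-[] : avoiderSeries [] ≈ 0#
avoiderSeries-[] n k = cong (ℤ.+_ ∘ length)
  (filter-none (λ b → ¬? ([] ⊑? b)) 
    (All.universal (λ b ¬[]⊑b → ¬[]⊑b (minimum b)) (compositions n k)))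

-- Entries are parts minus one, whence `suc m`. At threshold `m` the modified comparison is the
-- original one, so `C m` is `c` and the threshold identity closes up.
avoiderSeries-∷ : ∀ m a →
  denominator (suc m) * avoiderSeries (m ∷ a) ≈
  1# - X + X ^ suc m * Y * avoiderSeries a
avoiderSeries-∷ m a =
  subtractive-form X Y (X ^ suc m) c (avoiderSeries a)
    (S.trans (λ n k → cong (λ z → z ℤ.+ (X ^ suc m * Y * c) n k ℤ.+ X n k) (≡.sym (C≈c n k)))
      (S.trans
        (threshold X Y c (avoiderSeries a) C base step m)
        λ n k → cong (ℤ._+_ ((1# + X * Y * c + X ^ suc m * Y * avoiderSeries a) n k)) (XC≈Xc n k)))
  where
  c : Series
  c = avoiderSeries (m ∷ a)
  C : ℕ → Series
  C = thresholdSeries m a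
  C≈c : C m ≈ c
  C≈c n k = cong ℤ.+_
    (count-¬-≐ (occurs? m a m) (m ∷ a ⊑?_) (occurs-≐ m a) (compositions n k))
  XC≈Xc : X * C m ≈ X * c
  XC≈Xc = S.*-congˡ {X} {C m} {c} C≈c
  base : C 0 + X ≈ 1# + X * Y * avoiderSeries a + X * C 0
  base = recurrence (C 0) (C 0) (avoiderSeries a)
    ≡.refl (λ _ → ≡.refl) ≡.refl (λ _ → ≡.refl) (λ _ → ≡.refl)
    (count-compositions (occurs? m a 0) (a ⊑?_) (occurs? m a 0)
      (occurs-zero-∷ m a) (occurs-zero-increment m a))
  step : ∀ s → C (suc s) + X ≈ 1# + X * Y * c + X * C s
  step s = recurrence (C s) (C (suc s)) c
    ≡.refl (λ _ → ≡.refl) ≡.refl (λ _ → ≡.refl) (λ _ → ≡.refl)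
    (count-compositions (occurs? m a (suc s)) (m ∷ a ⊑?_) (occurs? m a s)
      (occurs-suc-∷ m a s) (occurs-suc-increment m a s))

-- Pattern containment as relabelling

-- Restricted to the letters of `τ`, because an occurrence determines a relabelling only there.
IncreasingOn : Word → (ℕ → ℕ) → Set
IncreasingOn τ φ = ∀ {c d} → c ∈ τ → d ∈ τ → c < d → φ c < φ d

embedding : ∀ (φ : ℕ → ℕ) τ {π} → map φ τ ⊆ π → Fin (length τ) → Fin (length π)
embedding φ (c ∷ τ) (y ∷ʳ s) i       = suc (embedding φ (c ∷ τ) s i)
embedding φ (c ∷ τ) (r ∷ s)  zero    = zero
embedding φ (c ∷ τ) (r ∷ s)  (suc i) = suc (embedding φ τ s i)

embedding-increasing : ∀ φ τ {π} (s : map φ τ ⊆ π) → StrictlyIncreasing (embedding φ τ s)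
embedding-increasing φ (c ∷ τ) (y ∷ʳ s) i       j       i<j       =
  s≤s (embedding-increasing φ (c ∷ τ) s i j i<j)
embedding-increasing φ (c ∷ τ) (r ∷ s)  zero    (suc j) i<j       = s≤s z≤n
embedding-increasing φ (c ∷ τ) (r ∷ s)  (suc i) (suc j) (s≤s i<j) =
  s≤s (embedding-increasing φ τ s i j i<j)

lookup-embedding : ∀ φ τ {π} (s : map φ τ ⊆ π) i →
  lookup π (embedding φ τ s i) ≡ φ (lookup τ i)
lookup-embedding φ (c ∷ τ) (y ∷ʳ s)     i       = lookup-embedding φ (c ∷ τ) s i
lookup-embedding φ (c ∷ τ) (≡.refl ∷ s) zero    = ≡.refl
lookup-embedding φ (c ∷ τ) (r ∷ s)      (suc i) = lookup-embedding φ τ s i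

increasingOn-reflects : ∀ {τ φ} → IncreasingOn τ φ →
  ∀ {c d} → c ∈ τ → d ∈ τ → φ c < φ d → c < d
increasingOn-reflects φ↑ {c} {d} c∈τ d∈τ φc<φd with ℕ.<-cmp c d
... | tri< c<d _ _    = c<d
... | tri≈ _ ≡.refl _ = contradiction φc<φd (ℕ.<-irrefl ≡.refl)
... | tri> _ _ d<c    = contradiction φc<φd (ℕ.<-asym (φ↑ d∈τ c∈τ d<c))

relabelling⇒contains : ∀ {π τ} φ → IncreasingOn τ φ → map φ τ ⊆ π → Contains π τ
relabelling⇒contains {π} {τ} φ φ↑ s = f , embedding-increasing φ τ s , λ i j → iso i j , iso j i
  where
  f : Fin (length τ) → Fin (length π)
  f = embedding φ τ s
  iso : ∀ i j → _
  iso i j = mk⇔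
    (λ lt → increasingOn-reflects φ↑ (∈-lookup i) (∈-lookup j)
      (≡.subst₂ _<_ (lookup-embedding φ τ s i) (lookup-embedding φ τ s j) lt))
    (λ lt → ≡.subst₂ _<_ (≡.sym (lookup-embedding φ τ s i)) (≡.sym (lookup-embedding φ τ s j))
      (φ↑ (∈-lookup i) (∈-lookup j) lt))

unsuc : ∀ {m n} (f : Fin m → Fin (suc n)) → (∀ i → f i ≢ zero) →
  ∃ λ g → ∀ i → f i ≡ suc (g i)
unsuc f f≢0 = (λ i → proj₁ (go (f i) (f≢0 i))) , λ i → proj₂ (go (f i) (f≢0 i))
  where
  go : ∀ {n} (x : Fin (suc n)) → x ≢ zero → ∃ λ y → x ≡ suc y
  go zero    x≢0 = contradiction ≡.refl x≢0
  go (suc y) _   = y , ≡.refl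

-- Recursion on `π`: by monotonicity only `f zero` can hit the first position, so the other values
-- factor through `suc`.
subsequence : ∀ {m} (π : Word) (f : Fin m → Fin (length π)) → StrictlyIncreasing f →
  tabulate (lookup π ∘ f) ⊆ π
subsequence {zero}  π       f f↑ = minimum π
subsequence {suc m} []      f f↑ = contradiction (f zero) λ ()
subsequence {suc m} (x ∷ π) f f↑ with f zero in f0≡
... | zero = ≡.refl ∷ ≡.subst (_⊆ π) (tabulate-cong λ i → cong (lookup (x ∷ π)) (≡.sym (f≡ i)))
    (subsequence π g λ i j i<j →
      ℕ.s≤s⁻¹ (≡.subst₂ Fin._<_ (f≡ i) (f≡ j) (f↑ (suc i) (suc j) (s≤s i<j))))
  where
  positive : ∀ i → f (suc i) ≢ zero
  positive i eq = contradiction (≡.subst₂ Fin._<_ f0≡ eq (f↑ zero (suc i) (s≤s z≤n))) λ ()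
  g = proj₁ (unsuc (f ∘ suc) positive)
  f≡ = proj₂ (unsuc (f ∘ suc) positive)
... | suc y = x ∷ʳ ≡.subst (_⊆ π)
    (≡.cong₂ _∷_ (cong (lookup (x ∷ π)) (≡.trans (≡.sym (f≡ zero)) f0≡))
      (tabulate-cong λ i → cong (lookup (x ∷ π)) (≡.sym (f≡ (suc i)))))
    (subsequence π g λ i j i<j → ℕ.s≤s⁻¹ (≡.subst₂ Fin._<_ (f≡ i) (f≡ j) (f↑ i j i<j)))
  where
  positive : ∀ i → f i ≢ zero
  positive zero    eq = contradiction (≡.trans (≡.sym f0≡) eq) λ ()
  positive (suc i) eq = contradiction (≡.subst₂ Fin._<_ f0≡ eq (f↑ zero (suc i) (s≤s z≤n))) λ ()
  g = proj₁ (unsuc f positive)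
  f≡ = proj₂ (unsuc f positive)

-- A letter is sent to the image of its first position found in `τ`. The choice of position does not
-- matter: by trichotomy, order isomorphism sends equal letters to equal letters.
contains⇒relabelling : ∀ {π τ} → Contains π τ → ∃ λ φ → IncreasingOn τ φ × map φ τ ⊆ π
contains⇒relabelling {π} {τ} (f , f↑ , iso) = φ , φ↑ ,
  ≡.subst (_⊆ π) (≡.sym map-φ) (subsequence π f f↑)
  where
  σ : Fin (length τ) → ℕ
  σ = lookup π ∘ f

  φ : ℕ → ℕ
  φ c with c ∈? τ
  ... | yes c∈τ = σ (Any.index c∈τ)
  ... | no  _   = 0

  σ-cong : ∀ i j → lookup τ i ≡ lookup τ j → σ i ≡ σ j
  σ-cong i j eq with ℕ.<-cmp (σ i) (σ j)
  ... | tri< lt _ _ = contradiction (Equivalence.to (proj₁ (iso i j)) lt) (ℕ.<-irrefl eq)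
  ... | tri≈ _ e _  = e
  ... | tri> _ _ gt = contradiction (Equivalence.to (proj₂ (iso i j)) gt) (ℕ.<-irrefl (≡.sym eq))

  φ-lookup : ∀ i → φ (lookup τ i) ≡ σ i
  φ-lookup i with lookup τ i ∈? τ
  ... | yes c∈τ = σ-cong _ i (≡.sym (Any.lookup-index c∈τ))
  ... | no  c∉τ = contradiction (∈-lookup i) c∉τ

  map-φ : map φ τ ≡ tabulate σ
  map-φ = begin
    map φ τ                     ≡⟨ cong (map φ) (tabulate-lookup τ) ⟨
    map φ (tabulate (lookup τ)) ≡⟨ map-tabulate (lookup τ) φ ⟩
    tabulate (φ ∘ lookup τ)     ≡⟨ tabulate-cong φ-lookup ⟩
    tabulate σ                  ∎
    where open ≡-Reasoning

  φ↑ : IncreasingOn τ φ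
  φ↑ c∈τ d∈τ c<d = ≡.subst₂ _<_ (σ≡φ c∈τ) (σ≡φ d∈τ)
    (Equivalence.from (proj₁ (iso (Any.index c∈τ) (Any.index d∈τ)))
      (≡.subst₂ _<_ (Any.lookup-index c∈τ) (Any.lookup-index d∈τ) c<d))
    where
    σ≡φ : ∀ {c} (c∈τ : c ∈ τ) → σ (Any.index c∈τ) ≡ φ c
    σ≡φ c∈τ = ≡.trans (≡.sym (φ-lookup (Any.index c∈τ))) (cong φ (≡.sym (Any.lookup-index c∈τ)))

-- The word of a composition

-- The decreasing suffix with letters counted from 0: splitting off the first part raises the other
-- letters by one, in step with `upTo-suc`.
descent : List ℕ → Word
descent []      = []
descent (x ∷ b) = map suc (descent b) ++ replicate x 0

word : List ℕ → Word
word b = map suc (upTo (length b) ++ descent b)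

word-split : ∀ b → word b ≡ letters (length b) ++ map suc (descent b)
word-split b = map-++ suc (upTo (length b)) (descent b)

upTo-suc : ∀ n → upTo (suc n) ≡ 0 ∷ map suc (upTo n)
upTo-suc n = cong (0 ∷_) (≡.sym (map-upTo suc n))

τ₁₁₂-descent : ∀ a →
  concatMap (λ i → replicate (lookup a i ℕ.∸ 1) (suc (toℕ i))) (reverse (allFin (length a))) ≡
  map suc (descent (map pred a))
τ₁₁₂-descent []      = ≡.refl
τ₁₁₂-descent (x ∷ a) = begin
  concatMap f (reverse (zero ∷ tabulate suc))
    ≡⟨ cong (λ is → concatMap f (reverse (zero ∷ is))) (map-tabulate id suc) ⟨
  concatMap f (reverse (zero ∷ map suc is))
    ≡⟨ cong (concatMap f) (unfold-reverse zero (map suc is)) ⟩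
  concatMap f (reverse (map suc is) ++ zero ∷ [])
    ≡⟨ cong (λ js → concatMap f (js ++ zero ∷ [])) (reverse-map suc is) ⟨
  concatMap f (map suc (reverse is) ++ zero ∷ [])
    ≡⟨ concatMap-++ f (map suc (reverse is)) (zero ∷ []) ⟩
  concatMap f (map suc (reverse is)) ++ replicate (x ℕ.∸ 1) 1 ++ []
    ≡⟨ ≡.cong₂ _++_ (concatMap-map f suc (reverse is)) (++-identityʳ _) ⟩
  concatMap (f ∘ suc) (reverse is) ++ replicate (x ℕ.∸ 1) 1
    ≡⟨ ≡.cong₂ _++_
         (concatMap-cong (λ i → ≡.sym (map-replicate suc (lookup a i ℕ.∸ 1) (suc (toℕ i))))
           (reverse is))
         (≡.sym (map-replicate suc (x ℕ.∸ 1) 0)) ⟩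
  concatMap (map suc ∘ g) (reverse is) ++ map suc (replicate (x ℕ.∸ 1) 0)
    ≡⟨ cong (_++ map suc (replicate (x ℕ.∸ 1) 0)) (map-concatMap suc g (reverse is)) ⟨
  map suc (concatMap g (reverse is)) ++ map suc (replicate (x ℕ.∸ 1) 0)
    ≡⟨ map-++ suc (concatMap g (reverse is)) (replicate (x ℕ.∸ 1) 0) ⟨
  map suc (concatMap g (reverse is) ++ replicate (x ℕ.∸ 1) 0)
    ≡⟨ cong (λ u → map suc (u ++ replicate (x ℕ.∸ 1) 0)) (τ₁₁₂-descent a) ⟩
  map suc (descent (map pred (x ∷ a))) ∎
  where
  open ≡-Reasoning
  is = allFin (length a)
  f : Fin (suc (length a)) → Word
  f i = replicate (lookup (x ∷ a) i ℕ.∸ 1) (suc (toℕ i))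
  g : Fin (length a) → Word
  g i = replicate (lookup a i ℕ.∸ 1) (suc (toℕ i))

τ₁₁₂≡word : ∀ a → τ₁₁₂ a ≡ word (map pred a)
τ₁₁₂≡word a = begin
  letters (length a) ++ _
    ≡⟨ ≡.cong₂ _++_ (cong letters (≡.sym (length-map pred a))) (τ₁₁₂-descent a) ⟩
  letters (length (map pred a)) ++ map suc (descent (map pred a))
    ≡⟨ word-split (map pred a) ⟨
  word (map pred a) ∎
  where open ≡-Reasoning

length-descent : ∀ b → length (descent b) ≡ sum b
length-descent []      = ≡.refl
length-descent (x ∷ b) = begin
  length (map suc (descent b) ++ replicate x 0)         ≡⟨ length-++ (map suc (descent b)) ⟩
  length (map suc (descent b)) ℕ.+ length (replicate x 0)
    ≡⟨ ≡.cong₂ ℕ._+_ (≡.trans (length-map suc (descent b)) (length-descent b)) (length-replicate x) ⟩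
  sum b ℕ.+ x ≡⟨ ℕ.+-comm (sum b) x ⟩
  x ℕ.+ sum b ∎
  where open ≡-Reasoning

length-word : ∀ b → length (word b) ≡ length b ℕ.+ sum b
length-word b = begin
  length (word b)                                      ≡⟨ length-map suc (upTo (length b) ++ descent b) ⟩
  length (upTo (length b) ++ descent b)                ≡⟨ length-++ (upTo (length b)) ⟩
  length (upTo (length b)) ℕ.+ length (descent b)
    ≡⟨ ≡.cong₂ ℕ._+_ (length-upTo (length b)) (length-descent b) ⟩
  length b ℕ.+ sum b                                   ∎
  where open ≡-Reasoning

-- Multiplicities of letters

occurrences : ℕ → Word → ℕ
occurrences c = count (c ℕ.≟_)

-- Other letters may also be sent to `φ c`, hence only an inequality.
occurrences-map : ∀ φ c π → occurrences c π ≤ occurrences (φ c) (map φ π)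
occurrences-map φ c π = ℕ.≤-trans
  (Sublist.length-mono-≤ (Sublist.⊆-filter-Sublist (c ℕ.≟_) (λ d → φ c ℕ.≟ φ d)
    (λ { ≡.refl ≡.refl → ≡.refl }) (⊆-refl {x = π})))
  (ℕ.≤-reflexive (≡.sym (count-map (φ c ℕ.≟_) φ π)))

occurrences-mono : ∀ c {σ π} → σ ⊆ π → occurrences c σ ≤ occurrences c π
occurrences-mono c s = Sublist.length-mono-≤ (Sublist.⊆-filter-Sublist (c ℕ.≟_) (c ℕ.≟_)
  (λ { ≡.refl ≡.refl → ≡.refl }) s)

occurrences-∉ : ∀ c {π} → c ∉ π → occurrences c π ≡ 0
occurrences-∉ c c∉π = cong length (filter-none (c ℕ.≟_) (All.¬Any⇒All¬ _ c∉π))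

occurrences-zero-map-suc : ∀ π → occurrences 0 (map suc π) ≡ 0
occurrences-zero-map-suc π = occurrences-∉ 0 {map suc π} λ 0∈ →
  contradiction (proj₂ (proj₂ (∈-map⁻ suc 0∈))) λ ()

occurrences-suc-map-suc : ∀ i π → occurrences (suc i) (map suc π) ≡ occurrences i π
occurrences-suc-map-suc i π = ≡.trans (count-map (suc i ℕ.≟_) suc π)
  (cong length (filter-≐ (λ d → suc i ℕ.≟ suc d) (i ℕ.≟_) (ℕ.suc-injective , cong suc) π))

occurrences-zero-replicate : ∀ x → occurrences 0 (replicate x 0) ≡ x
occurrences-zero-replicate zero    = ≡.refl
occurrences-zero-replicate (suc x) = cong suc (occurrences-zero-replicate x)

occurrences-suc-replicate : ∀ i x → occurrences (suc i) (replicate x 0) ≡ 0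
occurrences-suc-replicate i zero    = ≡.refl
occurrences-suc-replicate i (suc x) = occurrences-suc-replicate i x

-- The true part: the stored entry counts the copies in the suffix, and `suc` adds the one in the
-- prefix. The value 0 past the end lets `part` determine the length too.
part : List ℕ → ℕ → ℕ
part []      i       = 0
part (x ∷ b) zero    = suc x
part (x ∷ b) (suc i) = part b i

occurrences-unshifted : ∀ b i → occurrences i (upTo (length b) ++ descent b) ≡ part b i
occurrences-unshifted []      i    = ≡.refl
occurrences-unshifted (x ∷ b) zero = begin
  occurrences 0 (upTo (suc (length b)) ++ descent (x ∷ b))
    ≡⟨ cong (λ u → occurrences 0 (u ++ descent (x ∷ b))) (upTo-suc (length b)) ⟩
  suc (occurrences 0 (map suc (upTo (length b)) ++ map suc (descent b) ++ replicate x 0))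
    ≡⟨ cong suc (count-++ (0 ℕ.≟_) (map suc (upTo (length b))) _) ⟩
  suc (occurrences 0 (map suc (upTo (length b))) ℕ.+
       occurrences 0 (map suc (descent b) ++ replicate x 0))
    ≡⟨ cong suc (≡.cong₂ ℕ._+_ (occurrences-zero-map-suc (upTo (length b)))
         (count-++ (0 ℕ.≟_) (map suc (descent b)) (replicate x 0))) ⟩
  suc (occurrences 0 (map suc (descent b)) ℕ.+ occurrences 0 (replicate x 0))
    ≡⟨ cong suc (≡.cong₂ ℕ._+_ (occurrences-zero-map-suc (descent b)) (occurrences-zero-replicate x)) ⟩
  suc x ∎
  where open ≡-Reasoning
occurrences-unshifted (x ∷ b) (suc i) = begin
  occurrences (suc i) (upTo (suc (length b)) ++ descent (x ∷ b))
    ≡⟨ cong (λ u → occurrences (suc i) (u ++ descent (x ∷ b))) (upTo-suc (length b)) ⟩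
  occurrences (suc i) (map suc (upTo (length b)) ++ map suc (descent b) ++ replicate x 0)
    -- Once the letter 0 is discarded at both ends, what remains is `word b`.
    ≡⟨ cong (occurrences (suc i)) (++-assoc (map suc (upTo (length b))) _ _) ⟨
  occurrences (suc i) ((map suc (upTo (length b)) ++ map suc (descent b)) ++ replicate x 0)
    ≡⟨ count-++ (suc i ℕ.≟_) (map suc (upTo (length b)) ++ map suc (descent b)) (replicate x 0) ⟩
  occurrences (suc i) (map suc (upTo (length b)) ++ map suc (descent b)) ℕ.+
  occurrences (suc i) (replicate x 0)
    ≡⟨ ≡.cong₂ ℕ._+_ (cong (occurrences (suc i)) (≡.sym (map-++ suc (upTo (length b)) (descent b))))
         (occurrences-suc-replicate i x) ⟩
  occurrences (suc i) (word b) ℕ.+ 0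
    ≡⟨ ℕ.+-identityʳ _ ⟩
  occurrences (suc i) (word b)
    ≡⟨ occurrences-suc-map-suc i (upTo (length b) ++ descent b) ⟩
  occurrences i (upTo (length b) ++ descent b)
    ≡⟨ occurrences-unshifted b i ⟩
  part b i ∎
  where open ≡-Reasoning

occurrences-word : ∀ b i → occurrences (suc i) (word b) ≡ part b i
occurrences-word b i =
  ≡.trans (occurrences-suc-map-suc i (upTo (length b) ++ descent b)) (occurrences-unshifted b i)

part-injective : ∀ b b′ → (∀ i → part b i ≡ part b′ i) → b ≡ b′
part-injective []      []        eq = ≡.refl
part-injective []      (y ∷ b′)  eq = contradiction (eq 0) λ ()
part-injective (x ∷ b) []        eq = contradiction (eq 0) λ ()
part-injective (x ∷ b) (y ∷ b′)  eq =
  ≡.cong₂ _∷_ (ℕ.suc-injective (eq 0)) (part-injective b b′ (eq ∘ suc))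

word-injective : ∀ {b b′} → word b ≡ word b′ → b ≡ b′
word-injective {b} {b′} eq = part-injective b b′ λ i →
  ≡.trans (≡.sym (occurrences-word b i))
    (≡.trans (cong (occurrences (suc i)) eq) (occurrences-word b′ i))

-- Domination of compositions and containment of words

0<part : ∀ a {i} → i < length a → 0 < part a i
0<part (x ∷ a) {zero}  _         = s≤s z≤n
0<part (x ∷ a) {suc i} (s≤s i<n) = 0<part a i<n

part-∷ : ∀ y b {n} → 0 < n → part (y ∷ b) n ≡ part b (pred n)
part-∷ y b (s≤s _) = ≡.refl

-- Recursion on `b`: its first part is matched if `φ 0` is 0 and skipped otherwise, and the
-- remaining positive values of `φ` are lowered. `φ` cannot run past the end of `b`, where `part` is
-- 0.
parts⇒⊑ : ∀ a b (φ : ℕ → ℕ) →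
  (∀ {i j} → i < j → j < length a → φ i < φ j) →
  (∀ {i} → i < length a → part a i ≤ part b (φ i)) → a ⊑ b
parts⇒⊑ []      b       φ φ↑ a≤b = minimum b
parts⇒⊑ (x ∷ a) []      φ φ↑ a≤b = contradiction (a≤b {0} (s≤s z≤n)) λ ()
parts⇒⊑ (x ∷ a) (y ∷ b) φ φ↑ a≤b with φ 0 in φ0≡
... | zero = ℕ.s≤s⁻¹ (≡.subst (λ n → suc x ≤ part (y ∷ b) n) φ0≡ (a≤b (s≤s z≤n))) ∷
  parts⇒⊑ a b (pred ∘ φ ∘ suc)
    (λ i<j j<n → ℕ.pred-mono-< {{ℕ.>-nonZero (pos (ℕ.<-trans i<j j<n))}} (φ↑ (s≤s i<j) (s≤s j<n)))
    (λ i<n → ℕ.≤-trans (a≤b (s≤s i<n)) (ℕ.≤-reflexive (part-∷ y b (pos i<n))))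
  where
  pos : ∀ {i} → i < length a → 0 < φ (suc i)
  pos i<n = ≡.subst (_< φ _) φ0≡ (φ↑ (s≤s z≤n) (s≤s i<n))
... | suc z = y ∷ʳ parts⇒⊑ (x ∷ a) b (pred ∘ φ)
    (λ i<j j<n → ℕ.pred-mono-< {{ℕ.>-nonZero (pos (ℕ.<-trans i<j j<n))}} (φ↑ i<j j<n))
    (λ i<n → ℕ.≤-trans (a≤b i<n) (ℕ.≤-reflexive (part-∷ y b (pos i<n))))
  where
  pos : ∀ {i} → i < suc (length a) → 0 < φ i
  pos {zero}  _   = ≡.subst (0 <_) (≡.sym φ0≡) (s≤s z≤n)
  pos {suc i} i<n = ℕ.<-trans (pos {zero} (s≤s z≤n)) (φ↑ (s≤s z≤n) i<n)

∈-letters⁺ : ∀ {c k} → c < k → suc c ∈ letters k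
∈-letters⁺ c<k = ∈-map⁺ suc (∈-upTo⁺ c<k)

letters⊆word : ∀ {c} b → c < length b → suc c ∈ word b
letters⊆word {c} b c<k = ≡.subst (suc c ∈_) (≡.sym (word-split b)) (∈-++⁺ˡ (∈-letters⁺ c<k))

contains⇒⊑ : ∀ a b → Contains (word b) (word a) → a ⊑ b
contains⇒⊑ a b contains with contains⇒relabelling {word b} {word a} contains
... | φ , φ↑ , s = parts⇒⊑ a b (pred ∘ φ ∘ suc)
  (λ i<j j<n → ℕ.pred-mono-< {{ℕ.>-nonZero (0<φ (ℕ.<-trans i<j j<n))}}
    (φ↑ (letters⊆word a (ℕ.<-trans i<j j<n)) (letters⊆word a j<n) (s≤s i<j)))
  (λ {i} i<n → ℕ.≤-trans (part≤ i) (ℕ.≤-reflexive (≡.trans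
    (cong (λ c → occurrences c (word b)) (≡.sym (ℕ.suc-pred _ {{ℕ.>-nonZero (0<φ i<n)}})))
    (occurrences-word b (pred (φ (suc i)))))))
  where
  part≤ : ∀ i → part a i ≤ occurrences (φ (suc i)) (word b)
  part≤ i = begin
    part a i                                     ≡⟨ occurrences-word a i ⟨
    occurrences (suc i) (word a)                 ≤⟨ occurrences-map φ (suc i) (word a) ⟩
    occurrences (φ (suc i)) (map φ (word a))     ≤⟨ occurrences-mono (φ (suc i)) {map φ (word a)} {word b} s ⟩
    occurrences (φ (suc i)) (word b)             ∎
    where open ℕ.≤-Reasoning
  -- The letter `suc i` occurs in `word a`, so its image occurs in `word b`, which has no letter 0.
  0<φ : ∀ {i} → i < length a → 0 < φ (suc i)
  0<φ {i} i<n with φ (suc i) | part≤ i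
  ... | zero  | le = contradiction
        (ℕ.≤-trans (0<part a i<n) (ℕ.≤-trans le (ℕ.≤-reflexive
          (occurrences-zero-map-suc (upTo (length b) ++ descent b))))) λ ()
  ... | suc _ | _  = s≤s z≤n

-- Serves both to prepend a matched first part, whose letter 0 goes to 0, and to pass from letters
-- counted from 0 to letters counted from 1.
shifted : (ℕ → ℕ) → ℕ → ℕ
shifted φ zero    = 0
shifted φ (suc i) = suc (φ i)

shifted↑ : ∀ {φ} → (∀ {i j} → i < j → φ i < φ j) → ∀ {i j} → i < j → shifted φ i < shifted φ j
shifted↑ φ↑ {zero}  {suc j} _         = s≤s z≤n
shifted↑ φ↑ {suc i} {suc j} (s≤s i<j) = s≤s (φ↑ i<j)

shifted-⊆ : ∀ {φ u v} → map φ u ⊆ v → map (shifted φ) (map suc u) ⊆ map suc v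
shifted-⊆ {φ} {u} {v} s = ≡.subst (_⊆ map suc v)
  (≡.trans (≡.sym (map-∘ u)) (map-∘ u))
  (Sublist.map⁺ suc suc (Sublist.map (cong suc) s))

-- One `φ` must serve prefix and suffix at once. A skipped part raises all images by one; a matched
-- part fixes the letter 0, and its `x` copies fit into `y` since `x ≤ y`.
⊑⇒relabelling : ∀ {a b} → a ⊑ b → ∃ λ φ → (∀ {i j} → i < j → φ i < φ j) ×
  map φ (upTo (length a)) ⊆ upTo (length b) × map φ (descent a) ⊆ descent b
⊑⇒relabelling [] = id , id , [] , []
⊑⇒relabelling {a} {y ∷ b} (.y ∷ʳ a⊑b) with ⊑⇒relabelling a⊑b
... | φ , φ↑ , s , t = suc ∘ φ , (λ i<j → s≤s (φ↑ i<j)) ,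
  ≡.subst (map (suc ∘ φ) (upTo (length a)) ⊆_) (≡.sym (upTo-suc (length b))) (0 ∷ʳ suc-map s) ,
  Sublist.++ʳ (replicate y 0) (suc-map t)
  where
  suc-map : ∀ {u v} → map φ u ⊆ v → map (suc ∘ φ) u ⊆ map suc v
  suc-map {u} {v} r = ≡.subst (_⊆ map suc v) (≡.sym (map-∘ u))
    (Sublist.map⁺ suc suc (Sublist.map (cong suc) r))
⊑⇒relabelling {x ∷ a} {y ∷ b} (x≤y ∷ a⊑b) with ⊑⇒relabelling a⊑b
... | φ , φ↑ , s , t = shifted φ , shifted↑ φ↑ ,
  ≡.subst₂ (λ u v → map (shifted φ) u ⊆ v) (≡.sym (upTo-suc (length a))) (≡.sym (upTo-suc (length b)))
    (≡.refl ∷ shifted-⊆ s) ,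
  ≡.subst (_⊆ descent (y ∷ b)) (≡.sym (map-++ (shifted φ) (map suc (descent a)) (replicate x 0)))
    (Sublist.++⁺ (shifted-⊆ t)
      (≡.subst (_⊆ replicate y 0) (≡.sym (map-replicate (shifted φ) x 0)) (replicate⁺ x≤y)))
  where
  replicate⁺ : ∀ {x y} → x ≤ y → replicate x 0 ⊆ replicate y 0
  replicate⁺ z≤n       = minimum _
  replicate⁺ (s≤s x≤y) = ≡.refl ∷ replicate⁺ x≤y

⊑⇒contains : ∀ a b → a ⊑ b → Contains (word b) (word a)
⊑⇒contains a b a⊑b with ⊑⇒relabelling a⊑b
... | φ , φ↑ , s , t = relabelling⇒contains (shifted φ) (λ _ _ → shifted↑ φ↑)
  (shifted-⊆ (≡.subst (_⊆ upTo (length b) ++ descent b)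
    (≡.sym (map-++ φ (upTo (length a)) (descent a))) (Sublist.++⁺ s t)))

-- Partitions avoiding 112

112-pattern : Word
112-pattern = 1 ∷ 1 ∷ 2 ∷ []

112⇒contains : ∀ {π c d} → c < d → c ∷ c ∷ d ∷ [] ⊆ π → Contains π 112-pattern
112⇒contains {π} {c} {d} c<d s = relabelling⇒contains φ φ↑ s
  where
  φ : ℕ → ℕ
  φ 1 = c
  φ _ = d
  φ↑ : IncreasingOn 112-pattern φ
  φ↑ (here ≡.refl)                 (there (there (here ≡.refl))) _ = c<d
  φ↑ (there (here ≡.refl))         (there (there (here ≡.refl))) _ = c<d
  φ↑ (here ≡.refl)                 (here ≡.refl)         lt = contradiction lt (ℕ.<-irrefl ≡.refl)
  φ↑ (here ≡.refl)                 (there (here ≡.refl)) lt = contradiction lt (ℕ.<-irrefl ≡.refl)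
  φ↑ (there (here ≡.refl))         (here ≡.refl)         lt = contradiction lt (ℕ.<-irrefl ≡.refl)
  φ↑ (there (here ≡.refl))         (there (here ≡.refl)) lt = contradiction lt (ℕ.<-irrefl ≡.refl)
  φ↑ (there (there (here ≡.refl))) (here ≡.refl)         (s≤s ())
  φ↑ (there (there (here ≡.refl))) (there (here ≡.refl)) (s≤s ())
  φ↑ (there (there (here ≡.refl))) (there (there (here ≡.refl))) lt = contradiction lt (ℕ.<-irrefl ≡.refl)

contains⇒112 : ∀ {π} → Contains π 112-pattern → ∃ λ c → ∃ λ d → c < d × c ∷ c ∷ d ∷ [] ⊆ π
contains⇒112 contains with contains⇒relabelling contains
... | φ , φ↑ , s = φ 1 , φ 2 , φ↑ (here ≡.refl) (there (there (here ≡.refl))) (s≤s (s≤s z≤n)) , s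

position : ∀ (xs : Word) {x ys} → Fin (length (xs ++ x ∷ ys))
position []       = zero
position (_ ∷ xs) = suc (position xs)

lookup-position : ∀ (xs : Word) {x ys} → lookup (xs ++ x ∷ ys) (position xs) ≡ x
lookup-position []       = ≡.refl
lookup-position (_ ∷ xs) = lookup-position xs

take-position : ∀ (xs : Word) {x ys} → take (toℕ (position xs {x} {ys})) (xs ++ x ∷ ys) ≡ xs
take-position []       = ≡.refl
take-position (z ∷ xs) = cong (z ∷_) (take-position xs)

split-lookup : ∀ (π : Word) i → π ≡ take (toℕ i) π ++ lookup π i ∷ drop (suc (toℕ i)) π
split-lookup (x ∷ π) zero    = ≡.refl
split-lookup (x ∷ π) (suc i) = cong (x ∷_) (split-lookup π i)

growth-at : ∀ {k π} → IsPartition k π → ∀ xs {x ys} → π ≡ xs ++ x ∷ ys → x ≤ max 0 xs ℕ.+ 1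
growth-at part xs ≡.refl = ≡.subst₂ (λ x u → x ≤ max 0 u ℕ.+ 1)
  (lookup-position xs) (take-position xs) (IsPartition.growth part (position xs))

-- Separates the letters inside the prefix `p` from those preceded by all of `p`, the two cases in
-- checking growth.
split-++ : ∀ (xs : Word) {x ys} p {u} → xs ++ x ∷ ys ≡ p ++ u →
  (∃ λ ys′ → p ≡ xs ++ x ∷ ys′) ⊎ ((∀ {c} → c ∈ p → c ∈ xs) × x ∈ u)
split-++ xs {x} {ys} [] ≡.refl = inj₂ ((λ ()) , ∈-++⁺ʳ xs (here ≡.refl))
split-++ []       (z ∷ p) eq with ∷-injective eq
... | ≡.refl , _ = inj₁ (p , ≡.refl)
split-++ (w ∷ xs) (z ∷ p) eq with ∷-injective eq
... | ≡.refl , eq′ with split-++ xs p eq′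
...   | inj₁ (ys′ , ≡.refl)  = inj₁ (ys′ , ≡.refl)
...   | inj₂ (p⊆xs , x∈u) = inj₂ ((λ { (here e) → here e ; (there c∈p) → there (p⊆xs c∈p) }) , x∈u)

smaller-precedes : ∀ {c x} xs {ys} → AllPairs _<_ (xs ++ x ∷ ys) → c ∈ xs ++ x ∷ ys → c < x → c ∈ xs
smaller-precedes []       _          (here ≡.refl)  c<x = contradiction c<x (ℕ.<-irrefl ≡.refl)
smaller-precedes []       (x<ys ∷ _) (there c∈ys)   c<x =
  contradiction c<x (ℕ.<-asym (All.lookup x<ys c∈ys))
smaller-precedes (z ∷ xs) _          (here c≡z)     c<x = here c≡z
smaller-precedes (z ∷ xs) (_ ∷ s)    (there c∈)     c<x = there (smaller-precedes xs s c∈ c<x)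

letters-sorted : ∀ k → AllPairs _<_ (letters k)
letters-sorted k = AllPairs.map⁺ (AllPairs.map s≤s (AllPairs.applyUpTo⁺₁ id k λ i<j _ → i<j))

∈-letters⁻ : ∀ {c k} → c ∈ letters k → 1 ≤ c × c ≤ k
∈-letters⁻ c∈ with ∈-map⁻ suc c∈
... | _ , i∈ , ≡.refl = s≤s z≤n , ∈-upTo⁻ i∈

∈-letters : ∀ {c k} → 1 ≤ c → c ≤ k → c ∈ letters k
∈-letters (s≤s _) c≤k = ∈-letters⁺ c≤k

descent-< : ∀ b → All (_< length b) (descent b)
descent-< []      = []
descent-< (x ∷ b) = All.++⁺ (All.map⁺ (All.map s≤s (descent-< b))) (All.replicate⁺ x (s≤s z≤n))

descent-sorted : ∀ b → AllPairs ℕ._≥_ (descent b)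
descent-sorted []      = []
descent-sorted (x ∷ b) = AllPairs.++⁺
  (AllPairs.map⁺ (AllPairs.map s≤s (descent-sorted b)))
  (replicate-sorted x)
  (All.universal (λ _ → All.replicate⁺ x z≤n) _)
  where
  replicate-sorted : ∀ x → AllPairs ℕ._≥_ (replicate x 0)
  replicate-sorted zero    = []
  replicate-sorted (suc x) = All.replicate⁺ x z≤n ∷ replicate-sorted x

word-letters : ∀ b → All (λ c → 1 ≤ c × c ≤ length b) (word b)
word-letters b = All.map⁺ (All.map (λ c<k → s≤s z≤n , c<k)
  (All.++⁺ (All.tabulate ∈-upTo⁻) (descent-< b)))

word-growth : ∀ b xs {x ys} → word b ≡ xs ++ x ∷ ys → x ≤ max 0 xs ℕ.+ 1
word-growth b xs {x} {ys} eq = go x (All.lookup (word-letters b) x∈word) earlier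
  where
  x∈word : x ∈ word b
  x∈word = ≡.subst (x ∈_) (≡.sym eq) (∈-++⁺ʳ xs (here ≡.refl))
  -- All smaller letters come before `x`: by sortedness if `x` lies in the prefix, and otherwise
  -- because the whole prefix does. The letter `x - 1` then bounds the maximum.
  earlier : ∀ {c} → 1 ≤ c → c < x → c ∈ xs
  earlier {c} 1≤c c<x with split-++ xs (letters (length b)) (≡.trans (≡.sym eq) (word-split b))
                         | ∈-letters 1≤c (ℕ.<⇒≤ (ℕ.<-≤-trans c<x
                             (proj₂ (All.lookup (word-letters b) x∈word))))
  ... | inj₂ (letters⊆xs , _) | c∈letters = letters⊆xs c∈letters
  ... | inj₁ (ys′ , eq′)      | c∈letters = smaller-precedes xs
      (≡.subst (AllPairs _<_) eq′ (letters-sorted (length b))) (≡.subst (c ∈_) eq′ c∈letters) c<x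
  go : ∀ x → 1 ≤ x × x ≤ length b → (∀ {c} → 1 ≤ c → c < x → c ∈ xs) → x ≤ max 0 xs ℕ.+ 1
  go (suc zero)    _ _       = ℕ.m≤n+m 1 (max 0 xs)
  go (suc (suc x)) _ earlier = ℕ.≤-trans
    (s≤s (v≤max⁺ 0 xs (inj₂ (Any.map ℕ.≤-reflexive (earlier (s≤s z≤n) ℕ.≤-refl)))))
    (ℕ.≤-reflexive (ℕ.+-comm 1 (max 0 xs)))

word-isPartition : ∀ b → IsPartition (length b) (word b)
word-isPartition b = isPartition (word-letters b) (λ c → letters⊆word b (Fin.toℕ<n c))
  λ i → word-growth b (take (toℕ i) (word b)) (split-lookup (word b) i)

repeat-then-descends : ∀ {c d} p {u} → AllPairs ℕ._≥_ u → c ∉ p → c ∷ d ∷ [] ⊆ p ++ u → d ≤ c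
repeat-then-descends []      u↓      c∉p (≡.refl ∷ s) with u↓
... | c≥ ∷ _ = All.lookup c≥ (Sublist.toAny s)
repeat-then-descends []      (_ ∷ u↓) c∉p (_ ∷ʳ s) = repeat-then-descends [] u↓ c∉p s
repeat-then-descends (z ∷ p) u↓ c∉p (_ ∷ʳ s)     = repeat-then-descends p u↓ (c∉p ∘ there) s
repeat-then-descends (z ∷ p) u↓ c∉p (≡.refl ∷ s) = contradiction (here ≡.refl) c∉p

-- The strictly increasing `p` holds at most one `c`, so the second copy lies in `u`, where letters
-- only descend.
no-112 : ∀ {c d} p {u} → AllPairs _<_ p → AllPairs ℕ._≥_ u → c ∷ c ∷ d ∷ [] ⊆ p ++ u → d ≤ c
no-112 []      _          u↓ s            = repeat-then-descends [] u↓ (λ ()) (Sublist.∷ˡ⁻ s)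
no-112 (z ∷ p) (_ ∷ p↑)   u↓ (_ ∷ʳ s)     = no-112 p p↑ u↓ s
no-112 (z ∷ p) (z<p ∷ _)  u↓ (≡.refl ∷ s) =
  repeat-then-descends p u↓ (λ z∈p → ℕ.<-irrefl ≡.refl (All.lookup z<p z∈p)) s

word-avoids-112 : ∀ b → ¬ Contains (word b) 112-pattern
word-avoids-112 b contains with contains⇒112 contains
... | c , d , c<d , s = contradiction c<d (ℕ.≤⇒≯
  (no-112 (letters (length b)) (letters-sorted (length b))
    (AllPairs.map⁺ (AllPairs.map s≤s (descent-sorted b)))
    (≡.subst (c ∷ c ∷ d ∷ [] ⊆_) (word-split b) s)))

allPairs-⊆ : ∀ {R : ℕ → ℕ → Set} u → (∀ {c d} → c ∷ d ∷ [] ⊆ u → R c d) → AllPairs R u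
allPairs-⊆ []      r = []
allPairs-⊆ (c ∷ u) r = All.tabulate (λ d∈u → r (≡.refl ∷ Sublist.fromAny d∈u)) ∷
  allPairs-⊆ u (λ s → r (c ∷ʳ s))

letters-suc : ∀ m → letters (suc m) ≡ letters m ++ suc m ∷ []
letters-suc m = ≡.trans (cong (map suc) (≡.sym (upTo-∷ʳ m))) (map-++ suc (upTo m) (m ∷ []))

-- Suppose 1⋯m is followed by `x` other than m+1. Growth gives `x ≤ m`, so `x` is a repeat, and m+1
-- still has to appear later: together they form a 112.
starts-with-letters : ∀ {k π} → IsPartition k π → ¬ Contains π 112-pattern →
  ∀ m → m ≤ k → ∃ λ u → π ≡ letters m ++ u
starts-with-letters {k} {π} part avoids zero    _   = π , ≡.refl
starts-with-letters {k} {π} part avoids (suc m) m<k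
  with starts-with-letters part avoids m (ℕ.<⇒≤ m<k)
... | u , π≡ = go u π≡ m+1∈u
  where
  m+1∈π : suc m ∈ π
  m+1∈π = ≡.subst (λ n → suc n ∈ π) (Fin.toℕ-fromℕ< m<k) (IsPartition.onto part (Fin.fromℕ< m<k))
  m+1∈u : suc m ∈ u
  m+1∈u with ∈-++⁻ (letters m) (≡.subst (suc m ∈_) π≡ m+1∈π)
  ... | inj₁ ∈p = contradiction (proj₂ (∈-letters⁻ ∈p)) (ℕ.<⇒≱ ℕ.≤-refl)
  ... | inj₂ ∈u = ∈u
  go : ∀ u → π ≡ letters m ++ u → suc m ∈ u → ∃ λ u → π ≡ letters (suc m) ++ u
  go (x ∷ ys) π≡ m+1∈ with x ℕ.≟ suc m
  ... | yes ≡.refl = ys , (begin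
    π                              ≡⟨ π≡ ⟩
    letters m ++ suc m ∷ ys        ≡⟨ ++-assoc (letters m) (suc m ∷ []) ys ⟨
    (letters m ++ suc m ∷ []) ++ ys ≡⟨ cong (_++ ys) (letters-suc m) ⟨
    letters (suc m) ++ ys          ∎)
    where open ≡-Reasoning
  ... | no x≢m+1 = contradiction
    (112⇒contains (s≤s x≤m) (≡.subst (x ∷ x ∷ suc m ∷ [] ⊆_) (≡.sym π≡)
      (Sublist.++⁺ (Sublist.fromAny (∈-letters 1≤x x≤m)) (≡.refl ∷ Sublist.fromAny (m+1∈ys m+1∈)))))
    avoids
    where
    1≤x : 1 ≤ x
    1≤x = proj₁ (All.lookup (IsPartition.letters part)
      (≡.subst (x ∈_) (≡.sym π≡) (∈-++⁺ʳ (letters m) (here ≡.refl))))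
    x≤m : x ≤ m
    x≤m = ℕ.s≤s⁻¹ (ℕ.≤∧≢⇒< (ℕ.≤-trans (growth-at part (letters m) π≡)
      (ℕ.≤-trans (ℕ.+-monoˡ-≤ 1 (max≤v⁺ z≤n (All.tabulate (proj₂ ∘ ∈-letters⁻))))
        (ℕ.≤-reflexive (ℕ.+-comm m 1)))) x≢m+1)
    m+1∈ys : suc m ∈ x ∷ ys → suc m ∈ ys
    m+1∈ys (here eq)  = contradiction (≡.sym eq) x≢m+1
    m+1∈ys (there ∈ys) = ∈ys

-- In a weakly decreasing word the ones stand at the end; their number becomes the first entry of
-- the composition.
split-ones : ∀ {k} u → AllPairs ℕ._≥_ u → All (λ c → 1 ≤ c × c ≤ suc k) u →
  ∃ λ u′ → ∃ λ x → u ≡ map suc u′ ++ replicate x 1 ×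
    AllPairs ℕ._≥_ u′ × All (λ c → 1 ≤ c × c ≤ k) u′
split-ones []      _         _         = [] , 0 , ≡.refl , [] , []
split-ones (c ∷ u) (c≥ ∷ u↓) (c∈ ∷ u∈) with split-ones u u↓ u∈
split-ones (suc (suc c) ∷ u) (c≥ ∷ _) ((_ , s≤s c≤k) ∷ _) | u′ , x , ≡.refl , u′↓ , u′∈ =
  suc c ∷ u′ , x , ≡.refl ,
  All.map ℕ.s≤s⁻¹ (All.map⁻ (All.++⁻ˡ (map suc u′) c≥)) ∷ u′↓ , (s≤s z≤n , c≤k) ∷ u′∈
split-ones (1 ∷ u) _ _ | [] , x , ≡.refl , _ , _ = [] , suc x , ≡.refl , [] , []
split-ones (1 ∷ u) ((s≤s c≤0 ∷ _) ∷ _) _ | c ∷ u′ , x , ≡.refl , _ , (1≤c , _) ∷ _ =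
  contradiction (ℕ.≤-trans 1≤c c≤0) λ ()

descent-surjective : ∀ k u → AllPairs ℕ._≥_ u → All (λ c → 1 ≤ c × c ≤ k) u →
  ∃ λ b → length b ≡ k × u ≡ map suc (descent b)
descent-surjective zero []      _ _ = [] , ≡.refl , ≡.refl
descent-surjective zero (c ∷ u) _ ((1≤c , c≤0) ∷ _) = contradiction (ℕ.≤-trans 1≤c c≤0) λ ()
descent-surjective (suc k) u u↓ u∈ with split-ones u u↓ u∈
... | u′ , x , ≡.refl , u′↓ , u′∈ with descent-surjective k u′ u′↓ u′∈
... | b , ≡.refl , ≡.refl = x ∷ b , ≡.refl , ≡.sym (≡.trans
  (map-++ suc (map suc (descent b)) (replicate x 0))
  (cong (map suc (map suc (descent b)) ++_) (map-replicate suc x 0)))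

-- Every letter after the prefix 1⋯k already occurs in it, so an ascent in the remainder would
-- complete a 112 with that earlier copy.
word-surjective : ∀ {k π} → IsPartition k π → ¬ Contains π 112-pattern →
  ∃ λ b → length b ≡ k × π ≡ word b
word-surjective {k} {π} part avoids with starts-with-letters part avoids k ℕ.≤-refl
... | u , ≡.refl with descent-surjective k u
    (allPairs-⊆ u λ {c} {d} s → ℕ.≮⇒≥ λ c<d → avoids (112⇒contains c<d
      (Sublist.++⁺ (Sublist.fromAny (c∈letters s)) s)))
    (All.++⁻ʳ (letters k) (IsPartition.letters part))
  where
  c∈letters : ∀ {c d} → c ∷ d ∷ [] ⊆ u → c ∈ letters k
  c∈letters s with All.lookup (All.++⁻ʳ (letters k) (IsPartition.letters part)) (Sublist.toAny s)
  ... | 1≤c , c≤k = ∈-letters 1≤c c≤k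
... | b , ≡.refl , ≡.refl = b , ≡.refl , ≡.sym (word-split b)

-- Enumeration

∈-words⁺ : ∀ k π → All (_∈ letters k) π → π ∈ words (length π) k
∈-words⁺ k []      []        = here ≡.refl
∈-words⁺ k (c ∷ π) (c∈ ∷ π∈) = ∈-cartesianProductWith⁺ _∷_ c∈ (∈-words⁺ k π π∈)

∈-words⁻ : ∀ n k {π} → π ∈ words n k → length π ≡ n
∈-words⁻ zero    k (here ≡.refl) = ≡.refl
∈-words⁻ (suc n) k π∈ with ∈-cartesianProductWith⁻ _∷_ (letters k) (words n k) π∈
... | c , π , _ , π∈′ , ≡.refl = cong suc (∈-words⁻ n k π∈′)

words-unique : ∀ n k → Unique (words n k)
words-unique zero    k = [] ∷ []
words-unique (suc n) k = Unique.cartesianProductWith⁺ _∷_ ∷-injective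
  (Unique.map⁺ ℕ.suc-injective (Unique.upTo⁺ k)) (words-unique n k)

∈-compositions⁻ : ∀ n k {b} → b ∈ compositions n k → length b ≡ k × length b ℕ.+ sum b ≡ n
∈-compositions⁻ zero    zero    (here ≡.refl) = ≡.refl , ≡.refl
∈-compositions⁻ (suc n) (suc k) b∈ with ∈-++⁻ (map (0 ∷_) (compositions n k)) b∈
... | inj₁ b∈′ with ∈-map⁻ (0 ∷_) b∈′
...   | b , b∈″ , ≡.refl with ∈-compositions⁻ n k b∈″
...     | l , s = cong suc l , cong suc s
∈-compositions⁻ (suc n) (suc k) b∈ | inj₂ b∈′ with ∈-map⁻ increment b∈′
...   | b , b∈″ , ≡.refl with b | ∈-compositions⁻ n (suc k) b∈″
...     | y ∷ b | l , s = l , ≡.trans (cong suc (ℕ.+-suc (length b) (y ℕ.+ sum b))) (cong suc s)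

∈-compositions⁺ : ∀ n b → length b ℕ.+ sum b ≡ n → b ∈ compositions n (length b)
∈-compositions⁺ zero    []          _  = here ≡.refl
∈-compositions⁺ (suc n) (zero ∷ b)  eq =
  ∈-++⁺ˡ (∈-map⁺ (0 ∷_) (∈-compositions⁺ n b (ℕ.suc-injective eq)))
∈-compositions⁺ (suc n) (suc y ∷ b) eq =
  ∈-++⁺ʳ (map (0 ∷_) (compositions n (length b))) (∈-map⁺ increment
    (∈-compositions⁺ n (y ∷ b) (ℕ.suc-injective
      (≡.trans (cong suc (≡.sym (ℕ.+-suc (length b) (y ℕ.+ sum b)))) eq))))

increment-injective : ∀ {b b′} → increment b ≡ increment b′ → b ≡ b′
increment-injective {[]}    {[]}     _      = ≡.refl
increment-injective {y ∷ b} {.y ∷ .b} ≡.refl = ≡.refl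

compositions-unique : ∀ n k → Unique (compositions n k)
compositions-unique zero    zero    = [] ∷ []
compositions-unique zero    (suc k) = []
compositions-unique (suc n) zero    = []
compositions-unique (suc n) (suc k) = Unique.++⁺
  (Unique.map⁺ (λ { ≡.refl → ≡.refl }) (compositions-unique n k))
  (Unique.map⁺ increment-injective (compositions-unique n (suc k)))
  disjoint
  where
  disjoint : ∀ {b} →
    b ∈ map (0 ∷_) (compositions n k) × b ∈ map increment (compositions n (suc k)) → ⊥
  disjoint (b∈ , b∈′) with ∈-map⁻ (0 ∷_) b∈ | ∈-map⁻ increment b∈′
  ... | _ , _ , ≡.refl | []    , _ , ()
  ... | _ , _ , ≡.refl | _ ∷ _ , _ , ()

-- Two lists without repetitions and with the same members are permutations of each other, hence
-- equally long.
count-bijection : ∀ {P : Pred A 0ℓ} {Q : Pred B 0ℓ} (P? : Decidable P) (Q? : Decidable Q)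
  (f : B → A) → (∀ {y y′} → f y ≡ f y′ → y ≡ y′) →
  ∀ {xs ys} → Unique xs → Unique ys →
  (∀ {x} → x ∈ xs → P x → ∃ λ y → y ∈ ys × Q y × x ≡ f y) →
  (∀ {y} → y ∈ ys → Q y → f y ∈ xs × P (f y)) →
  count P? xs ≡ count Q? ys
count-bijection P? Q? f f-injective {xs} {ys} xs! ys! to from = ≡.trans
  (↭-length (∼bag⇒↭ (unique∧set⇒bag (Unique.filter⁺ P? xs!)
    (Unique.map⁺ f-injective (Unique.filter⁺ Q? ys!)) (mk⇔ to′ from′))))
  (length-map f (filter Q? ys))
  where
  to′ : ∀ {x} → x ∈ filter P? xs → x ∈ map f (filter Q? ys)
  to′ x∈ with ∈-filter⁻ P? {xs = xs} x∈
  ... | x∈xs , px with to x∈xs px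
  ... | y , y∈ys , qy , ≡.refl = ∈-map⁺ f (∈-filter⁺ Q? y∈ys qy)

  from′ : ∀ {x} → x ∈ map f (filter Q? ys) → x ∈ filter P? xs
  from′ x∈ with ∈-map⁻ f x∈
  ... | y , y∈ , ≡.refl with ∈-filter⁻ Q? {xs = ys} y∈
  ... | y∈ys , qy with from y∈ys qy
  ... | fy∈xs , pfy = ∈-filter⁺ P? fy∈xs pfy

p≡count : ∀ n k a → p n k (112-pattern ∷ word a ∷ []) ≡ count (λ b → ¬? (a ⊑? b)) (compositions n k)
p≡count n k a = count-bijection
  (λ π → isPartition? k π ×-dec avoids? T π) (λ b → ¬? (a ⊑? b)) word word-injective
  (words-unique n k) (compositions-unique n k) to from
  where
  T : List Word
  T = 112-pattern ∷ word a ∷ []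

  to : ∀ {π} → π ∈ words n k → IsPartition k π × Avoids T π →
    ∃ λ b → b ∈ compositions n k × ¬ (a ⊑ b) × π ≡ word b
  to π∈ (part , avoids-112 ∷ avoids-a ∷ []) with word-surjective part avoids-112
  ... | b , ≡.refl , ≡.refl = b ,
    ∈-compositions⁺ n b (≡.trans (≡.sym (length-word b)) (∈-words⁻ n k π∈)) ,
    avoids-a ∘ ⊑⇒contains a b , ≡.refl

  from : ∀ {b} → b ∈ compositions n k → ¬ (a ⊑ b) →
    word b ∈ words n k × IsPartition k (word b) × Avoids T (word b)
  from {b} b∈ a⋢b with ∈-compositions⁻ n k b∈
  ... | ≡.refl , size =
    ≡.subst (λ n → word b ∈ words n k) (≡.trans (length-word b) size)
      (∈-words⁺ k (word b) (All.map (λ (1≤c , c≤k) → ∈-letters 1≤c c≤k) (word-letters b))) ,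
    word-isPartition b , word-avoids-112 b ∷ (a⋢b ∘ contains⇒⊑ a b) ∷ []

-- The generating function

F≈avoiderSeries : ∀ a → F a ≈ avoiderSeries (map pred a)
F≈avoiderSeries a n k = cong ℤ.+_ (≡.trans
  (cong (λ τ → p n k (112-pattern ∷ τ ∷ [])) (τ₁₁₂≡word a)) (p≡count n k (map pred a)))

theorem2p5 : (a : List ℕ) → 1 ≤ length a → All (1 ≤_) a →
    F a ≈ ∑[ j < length a ]
    (X ^ sum (take j a) * Y ^ j * (1# - X)
    / ∏ (map (λ aᵢ → 1# - X * (1# + Y) + X ^ aᵢ * Y) (take (suc j) a)))
theorem2p5 a _ a≥1 n k = ≡.trans (F≈avoiderSeries a n k)
  -- The denominators use the parts themselves, `avoiderSeries` the parts minus one; on a part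
  -- `suc m` the `pred` computes away.
  (rational-form (avoiderSeries ∘ map pred) avoiderSeries-[]
    (λ m a → avoiderSeries-∷ m (map pred a)) a a≥1 n k)
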